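{- Every strictly supersolvable locally geometric poset is inductive.
   Context: All posets are finite, have a unique minimal element $\hat 0$, and are ranked (for every $x$ all maximal chains with top $x$ have the same length $\operatorname{rk}(x)$); $\operatorname{rk}(\mathcal{P}):=\max_x\operatorname{rk}(x)$. Characteristic polynomial: $\chi_{\mathcal{P}}(t)=\sum_{x}\mu(\hat0,x)t^{\operatorname{rk}(\mathcal{P})-\operatorname{rk}(x)}$, $\mu$ the Möbius function. $A(\mathcal{P})$ is the set of atoms (rank-1 elements). For $T\subseteq\mathcal{P}$, $\bigvee T$ is the set of minimal upper bounds of $T$; $x\vee y:=\bigvee\{x,y\}$. A lattice is geometric if for all $x,y$: $y$ covers $x$ iff there is an atom $a\not\le x$ with $y=x\vee a$. $\mathcal{P}$ is locally geometric if every $\mathcal{P}_{\le x}$ is a geometric lattice. An element $x$ of a geometric lattice $L$ is modular if $x\wedge(y\vee z)=(x\wedge y)\vee z$ for all $z\le x$, $y\in L$. For $B\subseteq A(\mathcal{P})$, $\mathcal{P}(B)$ is the subposet consisting of $\hat 0$ and all elements of $\bigvee T$ for nonempty $T\subseteq B$. An order ideal $\mathcal{Q}$ is pure if all its maximal elements have the same rank, and join-closed if $T\subseteq\mathcal{Q}$ implies $\bigvee T\subseteq\mathcal{Q}$. An M-ideal of a locally geometric $\mathcal{P}$ is a pure, join-closed order ideal $\mathcal{Q}$ with (1) $|a\vee y|\ge1$ for all $y\in\mathcal{Q}$, $a\in A(\mathcal{P})\setminus A(\mathcal{Q})$, and (2) for every maximal $x\in\mathcal{P}$ there is a maximal $y\in\mathcal{Q}$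 that is modular in $\mathcal{P}_{\le x}$. A TM-ideal is an M-ideal satisfying the stronger (1*) $|a\vee y|=1$ for all such $y,a$. $\mathcal{P}$ is strictly supersolvable if there is a chain $\{\hat0\}=\mathcal{Q}_0\subsetneq\mathcal{Q}_1\subsetneq\cdots\subsetneq\mathcal{Q}_r=\mathcal{P}$ with each $\mathcal{Q}_i$ a TM-ideal of $\mathcal{Q}_{i+1}$ and $\operatorname{rk}(\mathcal{Q}_i)=i$. For an atom $a$, let $\mathcal{P}':=\mathcal{P}(A(\mathcal{P})\setminus\{a\})$ and $\mathcal{P}'':=\mathcal{P}_{\ge a}$ (minimal element $a$, rank function $\operatorname{rk}-1$). The class of inductive posets is the smallest class of locally geometric posets such that (1) $\{\hat0\}$ is inductive, and (2) $\mathcal{P}$ is inductive whenever there is an atom $a$ with $\mathcal{P}''$ and $\mathcal{P}'$ inductive and $\chi_{\mathcal{P}''}(t)$ dividing $\chi_{\mathcal{P}'}(t)$. -}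

module Defs where

open import Algebra.Core using (Op₂)
open import Data.Bool.Properties using (T-≡)
open import Data.Fin using (Fin; toℕ; fromℕ; inject₁) renaming (zero to fzero; suc to fsuc)
open import Data.Fin.Induction using (po-wellFounded)
open import Data.Fin.Properties using (_≟_; all?)
open import Data.Fin.Subset
  using (Subset; _∈_; _⊆_; _⊂_; _∪_; _-_; ⁅_⁆; ∣_∣; Nonempty)
open import Data.Fin.Subset.Properties using (_∈?_; _⊆?_; nonempty?; anySubset?)
open import Data.Integer as ℤ using (ℤ; 0ℤ; 1ℤ)
import Data.Integer.Properties as ℤ
open import Data.Nat as ℕ using (ℕ; zero; suc; _⊔_; _∸_)
import Data.Nat.Properties as ℕ
open import Data.Product using (∃; _×_; _,_; proj₁; proj₂)
open import Data.Sum using (_⊎_; inj₁; inj₂)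
open import Data.Vec using (tabulate)
open import Data.Vec.Functional using (foldr)
open import Data.Vec.Properties using (lookup∘tabulate; lookup⇒[]=; []=⇒lookup)
open import Function using (_∘_; _on_; _⇔_; Equivalence)
open import Induction.WellFounded using (WellFounded; module All; module FixPoint)
open import Level using (0ℓ)
open import Relation.Binary using (Rel; IsDecPartialOrder)
import Relation.Binary.Construct.NonStrictToStrict as ToStrict
open import Relation.Binary.Lattice using (IsLattice)
open import Relation.Binary.PropositionalEquality
  using (_≡_; refl; sym; trans; cong)
open import Relation.Nullary using (¬_; Dec; yes; no)
open import Relation.Nullary.Decidable using (⌊_⌋; _×-dec_; _⊎-dec_; _→-dec_; toWitness; fromWitness)
open import Relation.Unary using (Pred; Decidable)

open import Algebra.Definitions.RawMonoid ℤ.+-0-rawMonoid using (sum)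

private
  variable
    n : ℕ

⟪_⟫ : {P : Pred (Fin n) 0ℓ} → Decidable P → Subset n
⟪ P? ⟫ = tabulate (⌊_⌋ ∘ P?)

module _ {P : Pred (Fin n) 0ℓ} (P? : Decidable P) where

  ∈⟪⟫⁺ : ∀ {x} → P x → x ∈ ⟪ P? ⟫
  ∈⟪⟫⁺ {x} px = lookup⇒[]= x ⟪ P? ⟫
    (trans (lookup∘tabulate (⌊_⌋ ∘ P?) x) (Equivalence.to T-≡ (fromWitness px)))

  ∈⟪⟫⁻ : ∀ {x} → x ∈ ⟪ P? ⟫ → P x
  ∈⟪⟫⁻ {x} x∈ = toWitness (Equivalence.from T-≡
    (trans (sym (lookup∘tabulate (⌊_⌋ ∘ P?) x)) ([]=⇒lookup x∈)))

maximum : (Fin n → ℕ) → ℕ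
maximum = foldr _⊔_ 0

given : {A B : Set} → Dec A → (A → B) → B → B
given (yes a) f b = f a
given (no _)  f b = b

record Polynomial : Set where
  field
    coeff  : ℕ → ℤ
    finite : ∃ λ d → ∀ k → d ℕ.< k → coeff k ≡ 0ℤ

open Polynomial public

_∣ᵖ_ : Polynomial → Polynomial → Set
p ∣ᵖ q = ∃ λ (r : Polynomial) → ∀ k →
  coeff q k ≡ sum {suc k} (λ i → coeff p (toℕ i) ℤ.* coeff r (k ∸ toℕ i))

-- Up to isomorphism, a finite poset is a subset of Fin n carrying the
-- restriction of a partial order on Fin n.  Posets with the same ambient
-- order O can be compared, so that the subposets of a poset P (intervals,
-- ideals, P(B), ...) are again of type FinitePoset O.
--
-- In a finite poset a unique minimal element is the same as a least element.
record FinitePoset {n} {_≤_ : Rel (Fin n) 0ℓ} (O : IsDecPartialOrder _≡_ _≤_) : Set where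
  field
    support : Subset n
    0̂       : Fin n
    0̂∈      : 0̂ ∈ support
    0̂-least : ∀ {x} → x ∈ support → 0̂ ≤ x

open FinitePoset public

module _ {n} {_≤_ : Rel (Fin n) 0ℓ} {O : IsDecPartialOrder _≡_ _≤_} where

  open IsDecPartialOrder O using (_≤?_; isPartialOrder)
    renaming (refl to ≤-refl)
  open ToStrict _≡_ _≤_ using (_<_; <-decidable)

  _<?_ : ∀ x y → Dec (x < y)
  _<?_ = <-decidable _≟_ _≤?_

  <-wf : WellFounded _<_
  <-wf = po-wellFounded isPartialOrder

  module _ (P : FinitePoset O) where

    Element : Set
    Element = ∃ λ x → x ∈ support P

    Maximal : Fin n → Set
    Maximal x = x ∈ support P × (∀ y → y ∈ support P → x ≤ y → y ≡ x)

    Covers : Fin n → Fin n → Set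
    Covers y x = x ∈ support P × y ∈ support P × x < y ×
      (∀ z → z ∈ support P → ¬ (x < z × z < y))

    rkStep : ∀ x → (∀ {y} → y < x → ℕ) → ℕ
    rkStep x rec = maximum λ y →
      given (y ∈? support P ×-dec y <? x) (λ p → suc (rec (proj₂ p))) 0

    -- The length of a longest chain with top x.  In a ranked poset (see
    -- Ranked below) it is the common length of all maximal ones.
    rk : Fin n → ℕ
    rk = All.wfRec <-wf 0ℓ (λ _ → ℕ) rkStep

    rank : ℕ
    rank = maximum λ x → given (x ∈? support P) (λ _ → rk x) 0

    μStep : ∀ x y → (∀ {z} → z < y → ℤ) → ℤ
    μStep x y rec = given (x ≟ y) (λ _ → 1ℤ)
      (ℤ.- sum λ z →
        given (z ∈? support P ×-dec x ≤? z ×-dec z <? y) (λ p → rec (proj₂ (proj₂ p))) 0ℤ)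

    μ : Fin n → Fin n → ℤ
    μ x = All.wfRec <-wf 0ℓ (λ _ → ℤ) (μStep x)

    χ-term : ℕ → Fin n → ℤ
    χ-term k x = given (x ∈? support P ×-dec (rank ∸ rk x) ℕ.≟ k) (λ _ → μ (0̂ P) x) 0ℤ

    χ : Polynomial
    χ = record
      { coeff  = λ k → sum (χ-term k)
      ; finite = rank , λ k rank<k → sum-zero (term-zero k rank<k)
      }
      where
      sum-zero : ∀ {m} {f : Fin m → ℤ} → (∀ i → f i ≡ 0ℤ) → sum f ≡ 0ℤ
      sum-zero {zero}  f≡0 = refl
      sum-zero {suc m} f≡0 rewrite f≡0 fzero =
        trans (ℤ.+-identityˡ _) (sum-zero (f≡0 ∘ fsuc))

      term-zero : ∀ k → rank ℕ.< k → ∀ x → χ-term k x ≡ 0ℤ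
      term-zero k rank<k x with x ∈? support P ×-dec (rank ∸ rk x) ℕ.≟ k
      ... | no  _          = refl
      ... | yes (_ , refl) with () ← ℕ.<⇒≱ rank<k (ℕ.m∸n≤m rank (rk x))

    IsChain : Subset n → Set
    IsChain C = C ⊆ support P × (∀ x y → x ∈ C → y ∈ C → x ≤ y ⊎ y ≤ x)

    ChainWithTop : Fin n → Subset n → Set
    ChainWithTop x C = IsChain C × x ∈ C × (∀ y → y ∈ C → y ≤ x)

    MaximalChainWithTop : Fin n → Subset n → Set
    MaximalChainWithTop x C = ChainWithTop x C × (∀ D → ChainWithTop x D → C ⊆ D → D ⊆ C)

    -- A chain with k + 1 elements has length k.
    Ranked : Set
    Ranked = ∀ x C → MaximalChainWithTop x C → ∣ C ∣ ≡ suc (rk x)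

    IsAtom : Fin n → Set
    IsAtom a = a ∈ support P × rk a ≡ 1

    atom? : Decidable IsAtom
    atom? a = a ∈? support P ×-dec rk a ℕ.≟ 1

    atoms : Subset n
    atoms = ⟪ atom? ⟫

    UpperBound : Subset n → Fin n → Set
    UpperBound T u = u ∈ support P × (∀ t → t ∈ T → t ≤ u)

    upperBound? : ∀ T → Decidable (UpperBound T)
    upperBound? T u = u ∈? support P ×-dec all? λ t → t ∈? T →-dec t ≤? u

    MinimalUpperBound : Subset n → Fin n → Set
    MinimalUpperBound T u = UpperBound T u × (∀ v → UpperBound T v → v ≤ u → v ≡ u)

    minimalUpperBound? : ∀ T → Decidable (MinimalUpperBound T)
    minimalUpperBound? T u =
      upperBound? T u ×-dec all? λ v → upperBound? T v →-dec (v ≤? u →-dec v ≟ u)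

    ⋁ : Subset n → Subset n
    ⋁ T = ⟪ minimalUpperBound? T ⟫

    -- The join as a set of elements, not as a lattice operation.
    infix 6 _∨ˢ_
    _∨ˢ_ : Fin n → Fin n → Subset n
    x ∨ˢ y = ⋁ (⁅ x ⁆ ∪ ⁅ y ⁆)

    below? : ∀ x → Decidable (λ y → y ∈ support P × y ≤ x)
    below? x y = y ∈? support P ×-dec y ≤? x

    above? : ∀ x → Decidable (λ y → y ∈ support P × x ≤ y)
    above? x y = y ∈? support P ×-dec x ≤? y

    infix 7 _↓_ _↑_

    _↓_ : Element → FinitePoset O
    _↓_ (x , x∈) = record
      { support = ⟪ below? x ⟫
      ; 0̂       = 0̂ P
      ; 0̂∈      = ∈⟪⟫⁺ (below? x) (0̂∈ P , 0̂-least P x∈)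
      ; 0̂-least = λ y∈ → 0̂-least P (proj₁ (∈⟪⟫⁻ (below? x) y∈))
      }

    _↑_ : Element → FinitePoset O
    _↑_ (x , x∈) = record
      { support = ⟪ above? x ⟫
      ; 0̂       = x
      ; 0̂∈      = ∈⟪⟫⁺ (above? x) (x∈ , ≤-refl)
      ; 0̂-least = λ y∈ → proj₂ (∈⟪⟫⁻ (above? x) y∈)
      }

    GeneratedBy : Subset n → Fin n → Set
    GeneratedBy B x = x ≡ 0̂ P ⊎ (∃ λ T → Nonempty T × T ⊆ B × x ∈ ⋁ T)

    generatedBy? : ∀ B → Decidable (GeneratedBy B)
    generatedBy? B x = x ≟ 0̂ P ⊎-dec
      anySubset? λ T → nonempty? T ×-dec T ⊆? B ×-dec x ∈? ⋁ T

    ⟨_⟩ : Subset n → FinitePoset O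
    ⟨ B ⟩ = record
      { support = ⟪ generatedBy? B ⟫
      ; 0̂       = 0̂ P
      ; 0̂∈      = ∈⟪⟫⁺ (generatedBy? B) (inj₁ refl)
      ; 0̂-least = λ x∈ → least (∈⟪⟫⁻ (generatedBy? B) x∈)
      }
      where
      least : ∀ {x} → GeneratedBy B x → 0̂ P ≤ x
      least (inj₁ refl)             = ≤-refl
      least (inj₂ (T , _ , _ , x∈)) =
        0̂-least P (proj₁ (proj₁ (∈⟪⟫⁻ (minimalUpperBound? T) x∈)))

    -- P′ and P″ for an atom a.
    deletion : Element → FinitePoset O
    deletion (a , _) = ⟨ atoms - a ⟩

    contraction : Element → FinitePoset O
    contraction a = _↑_ a

    infix 4 _≈_ _⊑_
    _≈_ _⊑_ : Rel Element 0ℓ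
    _≈_ = _≡_ on proj₁
    _⊑_ = _≤_ on proj₁

    record GeometricLattice : Set where
      infixr 6 _∨_
      infixr 7 _∧_
      field
        _∨_ _∧_   : Op₂ Element
        isLattice : IsLattice _≈_ _⊑_ _∨_ _∧_
        geometric : ∀ x y → Covers (proj₁ y) (proj₁ x) ⇔
          (∃ λ a → IsAtom (proj₁ a) × ¬ (a ⊑ x) × y ≈ x ∨ a)

    IsModular : GeometricLattice → Element → Set
    IsModular L x = ∀ y z → z ⊑ x → x ∧ (y ∨ z) ≈ (x ∧ y) ∨ z
      where open GeometricLattice L

  -- Every poset is assumed to be ranked.
  record LocallyGeometric (P : FinitePoset O) : Set where
    field
      ranked : Ranked P
      local  : ∀ x → GeometricLattice (P ↓ x)

  open LocallyGeometric

  -- Q is an M-ideal of the locally geometric poset P.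
  record IsMIdeal (P Q : FinitePoset O) : Set where
    field
      locallyGeometric : LocallyGeometric P
      subset           : support Q ⊆ support P
      downClosed       : ∀ x y → x ∈ support P → y ∈ support Q → x ≤ y → x ∈ support Q
      pure             : ∀ x y → Maximal Q x → Maximal Q y → rk Q x ≡ rk Q y
      joinClosed       : ∀ T → T ⊆ support Q → ⋁ P T ⊆ support Q
      joins            : ∀ a y → IsAtom P a → ¬ IsAtom Q a → y ∈ support Q →
                         ∣ _∨ˢ_ P a y ∣ ℕ.≥ 1
      modular          : ∀ (x : Element P) → Maximal P (proj₁ x) →
                         ∃ λ (y : Element (P ↓ x)) →
                           Maximal Q (proj₁ y) ×
                           IsModular (P ↓ x) (local locallyGeometric x) y

  record IsTMIdeal (P Q : FinitePoset O) : Set where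
    field
      isMIdeal    : IsMIdeal P Q
      uniqueJoins : ∀ a y → IsAtom P a → ¬ IsAtom Q a → y ∈ support Q →
                    ∣ _∨ˢ_ P a y ∣ ≡ 1

  record StrictlySupersolvable (P : FinitePoset O) : Set where
    field
      r        : ℕ
      Q        : Fin (suc r) → FinitePoset O
      bottom   : support (Q fzero) ≡ ⁅ 0̂ P ⁆
      top      : support (Q (fromℕ r)) ≡ support P
      strict   : ∀ i → support (Q (inject₁ i)) ⊂ support (Q (fsuc i))
      tmIdeals : ∀ i → IsTMIdeal (Q (fsuc i)) (Q (inject₁ i))
      ranks    : ∀ i → rank (Q i) ≡ toℕ i

  -- The one-element posets are locally geometric, so `point` does not ask for it.
  data Inductive : FinitePoset O → Set where
    point : ∀ {P} → support P ≡ ⁅ 0̂ P ⁆ → Inductive P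
    step  : ∀ {P} → LocallyGeometric P →
            (a : Element P) → IsAtom P (proj₁ a) →
            Inductive (contraction P a) → Inductive (deletion P a) →
            χ (contraction P a) ∣ᵖ χ (deletion P a) →
            Inductive P

  given-cong : {A B : Set} (d : Dec A) {f g : A → B} {b : B} →
               (∀ a → f a ≡ g a) → given d f b ≡ given d g b
  given-cong (yes a) f≗g = f≗g a
  given-cong (no _)  f≗g = refl

  foldr-cong : ∀ {A : Set} (_∙_ : A → A → A) (e : A) {m} {f g : Fin m → A} →
               (∀ i → f i ≡ g i) → foldr _∙_ e f ≡ foldr _∙_ e g
  foldr-cong _∙_ e {zero}  f≗g = refl
  foldr-cong _∙_ e {suc m} f≗g
    rewrite f≗g fzero | foldr-cong _∙_ e (f≗g ∘ fsuc) = refl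

  module _ (P : FinitePoset O) where

    rk-unfold : ∀ x → rk P x ≡
      maximum λ y → given (y ∈? support P ×-dec y <? x) (λ _ → suc (rk P y)) 0
    rk-unfold x = FixPoint.unfold-wfRec <-wf (λ _ → ℕ) (rkStep P)
      (λ x eq → foldr-cong _⊔_ 0 λ y →
        given-cong (y ∈? support P ×-dec y <? x) (λ p → cong suc (eq (proj₂ p))))

    μ-unfold : ∀ x y → μ P x y ≡ given (x ≟ y) (λ _ → 1ℤ)
      (ℤ.- sum λ z →
        given (z ∈? support P ×-dec x ≤? z ×-dec z <? y) (λ _ → μ P x z) 0ℤ)
    μ-unfold x y = FixPoint.unfold-wfRec <-wf (λ _ → ℤ) (μStep P x)
      (λ y eq → cong (given (x ≟ y) (λ _ → 1ℤ)) (cong ℤ.-_ (foldr-cong ℤ._+_ 0ℤ λ z →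
        given-cong (z ∈? support P ×-dec x ≤? z ×-dec z <? y)
          (λ p → eq (proj₂ (proj₂ p))))))

{-# OPTIONS --safe #-}

-- Let Q be a TM-ideal of P with rank P = rank Q + 1.  Modularity shows that
-- every x in P outside Q covers a greatest element π x of Q below it, and by
-- (1*) every atom a outside Q has a join with every y in Q.  Hence y ↦ a ∨ y
-- and π are inverse isomorphisms between Q and P″, while Q has the same
-- properties in P′.  Deleting the atoms outside Q one at a time leaves Q.
-- In each step the identity μ_P = μ_P′ − μ_P″ lowers the root of the factor
-- χ_P / χ_Q = t − |A(P) ∖ A(Q)| by one, so χ_P″ = χ_Q divides χ_P′ and P is
-- inductive if Q is.  The theorem follows by induction along the chain.

module Submission where

open import Defs
open import Data.Fin using (Fin; toℕ; fromℕ; inject₁) renaming (zero to fzero; suc to fsuc)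
open import Data.Fin.Induction using (po-noetherian; <-weakInduction)
open import Data.Fin.Properties using (_≟_; any?; toℕ-inject₁)
open import Data.Fin.Subset
  using (Subset; _∈_; _∉_; _⊆_; _∪_; _-_; ⁅_⁆; ∣_∣; inside; outside)
open import Data.Fin.Subset.Properties
open import Data.Integer as ℤ using (ℤ; 0ℤ; 1ℤ)
import Data.Integer.Properties as ℤ
open import Data.Nat as ℕ using (ℕ; zero; suc; _∸_; z≤n; s≤s)
open import Data.Nat.Induction using (<-wellFounded)
import Data.Nat.Properties as ℕ
open import Data.Product using (∃; _×_; _,_; proj₁; proj₂)
open import Data.Sum using (_⊎_; inj₁; inj₂)
open import Data.Vec using (_∷_; here; there)
open import Function using (_∘_; _⇔_; mk⇔; Equivalence)
open import Induction.WellFounded using (Acc; acc)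
open import Level using (0ℓ)
open import Relation.Binary using (Rel; IsDecPartialOrder)
import Relation.Binary.Construct.On as On
import Relation.Binary.Construct.NonStrictToStrict as ToStrict
open import Relation.Binary.Lattice using (IsLattice)
open import Relation.Binary.PropositionalEquality
  using (_≡_; _≢_; refl; sym; trans; cong; cong₂; subst; module ≡-Reasoning)
open import Relation.Nullary using (¬_; Dec; yes; no; contradiction)
open import Relation.Nullary.Decidable using (_×-dec_; ¬?)
open import Relation.Unary using (Pred; Decidable)
import Algebra.Properties.CommutativeMonoid.Sum ℤ.+-0-commutativeMonoid as Sum
open Sum using (sum)
import Algebra.Properties.AbelianGroup ℤ.+-0-abelianGroup as ℤ-Group

-- Modularity and purity speak of maximal elements, and these can change when an atom is deleted,
-- whereas `π x` and the joins `a ∨ y` stay the same. This is why the atoms are deleted from a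
-- `Fibration` and not from a TM-ideal. The relation between characteristic polynomials depends on
-- ranks: deleting the last atom outside Q lowers the rank, and then χ_P = t χ_P′ - χ_P″ instead of
-- χ_P = χ_P′ - χ_P″. The sums `X P s` measure coranks from an arbitrary `s`, so that a single
-- identity covers both cases; `s` becomes a rank only when divisibility is read off. Since P″ is
-- merely isomorphic to Q, `Inductive` has to be invariant under isomorphism, and local geometry has
-- to pass both to isomorphic posets and to P′. Bare statements about covers, atoms and joins are
-- easier to transport than chains and lattice structures.

-- Maxima, decisions and finite subsets.

maximum-upper : ∀ {m} (f : Fin m → ℕ) i → f i ℕ.≤ maximum f
maximum-upper f fzero    = ℕ.m≤m⊔n _ _
maximum-upper f (fsuc i) = ℕ.≤-trans (maximum-upper (f ∘ fsuc) i) (ℕ.m≤n⊔m _ _)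

maximum-attained : ∀ {m} (f : Fin m → ℕ) → maximum f ≡ 0 ⊎ (∃ λ i → maximum f ≡ f i)
maximum-attained {zero}  f = inj₁ refl
maximum-attained {suc m} f with ℕ.⊔-sel (f fzero) (maximum (f ∘ fsuc))
... | inj₁ eq = inj₂ (fzero , eq)
... | inj₂ eq with maximum-attained (f ∘ fsuc)
...   | inj₁ eq₀       = inj₁ (trans eq eq₀)
...   | inj₂ (i , eqᵢ) = inj₂ (fsuc i , trans eq eqᵢ)

given-yes : {A B : Set} (d : Dec A) {v b : B} → A → given d (λ _ → v) b ≡ v
given-yes (yes _) a = refl
given-yes (no ¬a) a = contradiction a ¬a

given-no : {A B : Set} (d : Dec A) {f : A → B} {b : B} → ¬ A → given d f b ≡ b
given-no (yes a) ¬a = contradiction a ¬a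
given-no (no _)  ¬a = refl

given-cases : {A B : Set} (d : Dec A) {v b : B} →
  (A × given d (λ _ → v) b ≡ v) ⊎ (¬ A × given d (λ _ → v) b ≡ b)
given-cases (yes a) = inj₁ (a , refl)
given-cases (no ¬a) = inj₂ (¬a , refl)

x∉p-x : ∀ {m} (p : Subset m) x → x ∉ p - x
x∉p-x p       fzero    x∈ with p | x∈
... | inside  ∷ _ | ()
... | outside ∷ _ | ()
x∉p-x (_ ∷ p) (fsuc x) (there x∈) = x∉p-x p x x∈

∈-⇒∈ : ∀ {m} {p : Subset m} {x y} → x ∈ p - y → x ∈ p
∈-⇒∈ {p = p} {y = y} = p─q⊆p p ⁅ y ⁆

∈-⇒≢ : ∀ {m} {p : Subset m} {x y} → x ∈ p - y → x ≢ y
∈-⇒≢ {p = p} x∈ refl = x∉p-x p _ x∈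

∣p∪⁅x⁆∣ : ∀ {m} (p : Subset m) x → x ∉ p → ∣ p ∪ ⁅ x ⁆ ∣ ≡ suc ∣ p ∣
∣p∪⁅x⁆∣ (inside  ∷ p) fzero    x∉ = contradiction here x∉
∣p∪⁅x⁆∣ (outside ∷ p) fzero    x∉ = cong (suc ∘ ∣_∣) (∪-identityʳ p)
∣p∪⁅x⁆∣ (inside  ∷ p) (fsuc x) x∉ = cong suc (∣p∪⁅x⁆∣ p x (x∉ ∘ there))
∣p∪⁅x⁆∣ (outside ∷ p) (fsuc x) x∉ = ∣p∪⁅x⁆∣ p x (x∉ ∘ there)

∈∪⁅⁆⁻ : ∀ {m} {p : Subset m} {x y} → y ∈ p ∪ ⁅ x ⁆ → y ∈ p ⊎ y ≡ x
∈∪⁅⁆⁻ {p = p} {x} y∈ with x∈p∪q⁻ p ⁅ x ⁆ y∈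
... | inj₁ y∈p = inj₁ y∈p
... | inj₂ y∈x = inj₂ (x∈⁅y⁆⇒x≡y x y∈x)

x∈p∪⁅x⁆ : ∀ {m} {p : Subset m} {x} → x ∈ p ∪ ⁅ x ⁆
x∈p∪⁅x⁆ {p = p} {x} = q⊆p∪q p ⁅ x ⁆ (x∈⁅x⁆ x)

p⊆p∪⁅x⁆ : ∀ {m} {p : Subset m} {x} → p ⊆ p ∪ ⁅ x ⁆
p⊆p∪⁅x⁆ {x = x} = p⊆p∪q ⁅ x ⁆

p-x∪⁅x⁆≡p : ∀ {m} {p : Subset m} {x} → x ∈ p → (p - x) ∪ ⁅ x ⁆ ≡ p
p-x∪⁅x⁆≡p {p = p} {x} x∈ = ⊆-antisym to from
  where
  to : (p - x) ∪ ⁅ x ⁆ ⊆ p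
  to y∈ with ∈∪⁅⁆⁻ y∈
  ... | inj₁ y∈- = ∈-⇒∈ y∈-
  ... | inj₂ refl = x∈
  from : p ⊆ (p - x) ∪ ⁅ x ⁆
  from {y} y∈ with y ≟ x
  ... | yes refl = x∈p∪⁅x⁆
  ... | no y≢x   = p⊆p∪⁅x⁆ (x∈p∧x≢y⇒x∈p-y y∈ y≢x)

∣p∣≡1⇒unique : ∀ {m} {p : Subset m} → ∣ p ∣ ≡ 1 → ∃ λ x → x ∈ p × (∀ {y} → y ∈ p → y ≡ x)
∣p∣≡1⇒unique {m} {p} ∣p∣≡1 with nonempty? p
... | no empty with () ← trans (sym ∣p∣≡1) (trans (cong ∣_∣ (Empty-unique empty)) (∣⊥∣≡0 m))
... | yes (x , x∈) = x , x∈ , λ {y} y∈ → equal y y∈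
  where
  equal : ∀ y → y ∈ p → y ≡ x
  equal y y∈ with y ≟ x
  ... | yes y≡x = y≡x
  ... | no y≢x  = contradiction
    (ℕ.≤-trans (x∈p⇒∣p-x∣<∣p∣ x∈) (ℕ.≤-reflexive ∣p∣≡1))
    (ℕ.<⇒≱ (s≤s (ℕ.≤-trans (s≤s z≤n) (x∈p⇒∣p-x∣<∣p∣ (x∈p∧x≢y⇒x∈p-y y∈ y≢x)))))

-- Sums over decidable subsets.

given-cong₂ : {A B : Set} (d : Dec A) (e : Dec B) {v w : ℤ} → (A → B) → (B → A) → (A → v ≡ w) →
  given d (λ _ → v) 0ℤ ≡ given e (λ _ → w) 0ℤ
given-cong₂ (yes a) e A→B B→A v≡w = trans (v≡w a) (sym (given-yes e (A→B a)))
given-cong₂ (no ¬a) e A→B B→A v≡w = sym (given-no e (¬a ∘ B→A))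

∑ : ∀ {m} {S : Pred (Fin m) 0ℓ} → Decidable S → (Fin m → ℤ) → ℤ
∑ S? f = sum λ x → given (S? x) (λ _ → f x) 0ℤ

sum-zero : ∀ {m} {f : Fin m → ℤ} → (∀ x → f x ≡ 0ℤ) → sum f ≡ 0ℤ
sum-zero {m} f≡0 = trans (Sum.sum-cong-≗ f≡0) (Sum.sum-replicate-zero m)

module _ {m} {S T : Pred (Fin m) 0ℓ} (S? : Decidable S) (T? : Decidable T) where

  ∑-cong : ∀ {f g} → (∀ {x} → S x → T x) → (∀ {x} → T x → S x) →
           (∀ {x} → S x → f x ≡ g x) → ∑ S? f ≡ ∑ T? g
  ∑-cong S→T T→S f≡g = Sum.sum-cong-≗ λ x → given-cong₂ (S? x) (T? x) S→T T→S f≡g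

  ∑-filter : ∀ f → ∑ S? (λ x → given (T? x) (λ _ → f x) 0ℤ) ≡ ∑ (λ x → S? x ×-dec T? x) f
  ∑-filter f = Sum.sum-cong-≗ λ x → filter (S? x) (T? x)
    where
    filter : ∀ {A B : Set} (d : Dec A) (e : Dec B) {v} →
      given d (λ _ → given e (λ _ → v) 0ℤ) 0ℤ ≡ given (d ×-dec e) (λ _ → v) 0ℤ
    filter (yes _) (yes _) = refl
    filter (yes _) (no _)  = refl
    filter (no _)  _       = refl

module _ {m} {S : Pred (Fin m) 0ℓ} (S? : Decidable S) where

  ∑-empty : ∀ {f} → (∀ {x} → ¬ S x) → ∑ S? f ≡ 0ℤ
  ∑-empty ¬S = sum-zero λ x → given-no (S? x) ¬S

  ∑-distrib-+ : ∀ f g → ∑ S? (λ x → f x ℤ.+ g x) ≡ ∑ S? f ℤ.+ ∑ S? g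
  ∑-distrib-+ f g = trans (Sum.sum-cong-≗ {m} λ x → distrib (S? x))
    (Sum.∑-distrib-+ (λ x → given (S? x) (λ _ → f x) 0ℤ) (λ x → given (S? x) (λ _ → g x) 0ℤ))
    where
    distrib : ∀ {A : Set} (d : Dec A) {v w} →
      given d (λ _ → v ℤ.+ w) 0ℤ ≡ given d (λ _ → v) 0ℤ ℤ.+ given d (λ _ → w) 0ℤ
    distrib (yes _) = refl
    distrib (no _)  = refl

∑-≟ : ∀ {m} (f : Fin m → ℤ) y → ∑ (_≟ y) f ≡ f y
∑-≟ {suc m} f fzero = trans (cong (λ v → f fzero ℤ.+ v) (sum-zero {m} λ _ → refl)) (ℤ.+-identityʳ _)
∑-≟ {suc m} f (fsuc y) = trans (ℤ.+-identityˡ _) (trans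
  (Sum.sum-cong-≗ {m} λ x →
    given-cong₂ (fsuc x ≟ fsuc y) (x ≟ y) (λ { refl → refl }) (cong fsuc) (λ _ → refl))
  (∑-≟ {m} (f ∘ fsuc) y))

∑-insert : ∀ {m} {S T : Pred (Fin m) 0ℓ} (S? : Decidable S) (T? : Decidable T) {y} f →
  S y → ¬ T y → (∀ {x} → T x → S x) → (∀ {x} → S x → x ≢ y → T x) →
  ∑ S? f ≡ f y ℤ.+ ∑ T? f
∑-insert {m} S? T? {y} f sy ¬ty T→S S→T = begin
  ∑ S? f                        ≡⟨ Sum.sum-cong-≗ {m} split ⟩
  sum (λ x → at-y x ℤ.+ in-T x) ≡⟨ Sum.∑-distrib-+ at-y in-T ⟩
  ∑ (_≟ y) f ℤ.+ ∑ T? f         ≡⟨ cong (λ v → v ℤ.+ ∑ T? f) (∑-≟ {m} f y) ⟩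
  f y ℤ.+ ∑ T? f                ∎
  where
  open ≡-Reasoning
  at-y in-T : Fin m → ℤ
  at-y x = given (x ≟ y) (λ _ → f x) 0ℤ
  in-T x = given (T? x) (λ _ → f x) 0ℤ
  split : ∀ x → given (S? x) (λ _ → f x) 0ℤ ≡
    given (x ≟ y) (λ _ → f x) 0ℤ ℤ.+ given (T? x) (λ _ → f x) 0ℤ
  split x with x ≟ y
  ... | yes refl = trans (given-yes (S? x) sy)
    (sym (trans (cong (λ v → f x ℤ.+ v) (given-no (T? x) ¬ty)) (ℤ.+-identityʳ _)))
  ... | no x≢y   = trans (given-cong₂ (S? x) (T? x) (λ sx → S→T sx x≢y) T→S (λ _ → refl))
    (sym (ℤ.+-identityˡ _))

-- Both sides sum `f y` over the graph of `to`, once by rows and once by columns. The maps are total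
-- on `Fin m` but are inverse to each other only between `S` and `T`.
∑-reindex : ∀ {m} {S T : Pred (Fin m) 0ℓ} (S? : Decidable S) (T? : Decidable T) 
  (f : Fin m → ℤ) (to from : Fin m → Fin m) →
  (∀ {x} → S x → T (to x)) → (∀ {y} → T y → S (from y)) →
  (∀ {x} → S x → from (to x) ≡ x) → (∀ {y} → T y → to (from y) ≡ y) →
  ∑ S? (f ∘ to) ≡ ∑ T? f
∑-reindex {m} S? T? f to from S→T T→S from-to to-from = begin
  ∑ S? (f ∘ to)             ≡⟨ Sum.sum-cong-≗ {m} expandˣ ⟩
  sum (λ x → sum λ y → g x y) ≡⟨ Sum.∑-comm {m} {m} g ⟩
  sum (λ y → sum λ x → g x y) ≡⟨ Sum.sum-cong-≗ {m} collapseʸ ⟩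
  ∑ T? f                    ∎
  where
  open ≡-Reasoning
  g : Fin m → Fin m → ℤ
  g x y = given (S? x ×-dec y ≟ to x) (λ _ → f y) 0ℤ
  expandˣ : ∀ x → given (S? x) (λ _ → f (to x)) 0ℤ ≡ sum λ y → g x y
  expandˣ x with S? x
  ... | no ¬s = sym (sum-zero {m} λ _ → refl)
  ... | yes s = sym (trans
    (∑-cong (λ y → yes s ×-dec y ≟ to x) (_≟ to x) proj₂ (s ,_) (λ _ → refl)) (∑-≟ {m} f (to x)))
  collapseʸ : ∀ y → sum (λ x → g x y) ≡ given (T? y) (λ _ → f y) 0ℤ
  collapseʸ y with T? y
  ... | no ¬t = ∑-empty (λ x → S? x ×-dec y ≟ to x) λ { (s , refl) → ¬t (S→T s) }
  ... | yes t = trans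
    (∑-cong (λ x → S? x ×-dec y ≟ to x) (_≟ from y) (λ { (s , refl) → sym (from-to s) })
      (λ { refl → T→S t , sym (to-from t) }) (λ _ → refl))
    (∑-≟ {m} (λ _ → f y) (from y))

∑-neg : ∀ {m} {S : Pred (Fin m) 0ℓ} (S? : Decidable S) f → ∑ S? (λ x → ℤ.- f x) ≡ ℤ.- ∑ S? f
∑-neg {zero}  S? f = refl
∑-neg {suc m} S? f = trans (cong₂ ℤ._+_ (neg (S? fzero)) (∑-neg (S? ∘ fsuc) (f ∘ fsuc)))
  (sym (ℤ.neg-distrib-+ (given (S? fzero) (λ _ → f fzero) 0ℤ) (∑ (S? ∘ fsuc) (f ∘ fsuc))))
  where
  neg : ∀ {A : Set} (d : Dec A) {v} → given d (λ _ → ℤ.- v) 0ℤ ≡ ℤ.- given d (λ _ → v) 0ℤ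
  neg (yes _) = refl
  neg (no _)  = refl

-- Products with polynomials of degree at most one.

linear : ℤ → ℤ → Polynomial
linear c d = record { coeff = r ; finite = 1 , r-finite }
  where
  r : ℕ → ℤ
  r 0             = c
  r 1             = d
  r (suc (suc _)) = 0ℤ
  r-finite : ∀ k → 1 ℕ.< k → r k ≡ 0ℤ
  r-finite (suc zero)    (s≤s ())
  r-finite (suc (suc _)) _ = refl

-- The cofactor is c + d t, so at most the last two terms of each convolution survive.
linear-∣ᵖ : ∀ {p q} c d → coeff q 0 ≡ coeff p 0 ℤ.* c →
  (∀ k → coeff q (suc k) ≡ coeff p k ℤ.* d ℤ.+ coeff p (suc k) ℤ.* c) → p ∣ᵖ q
linear-∣ᵖ {p} {q} c d q₀ q₊ = linear c d , λ where
    zero    → trans q₀ (sym (ℤ.+-identityʳ _))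
    (suc k) → trans (q₊ k) (sym (product (coeff p) k))
  where
  product : ∀ f k → sum {suc (suc k)} (λ i → f (toℕ i) ℤ.* coeff (linear c d) (suc k ∸ toℕ i)) ≡
    f k ℤ.* d ℤ.+ f (suc k) ℤ.* c
  product f zero    = cong (λ v → f 0 ℤ.* d ℤ.+ v) (ℤ.+-identityʳ _)
  -- The first summand meets a coefficient beyond degree 1 and vanishes; what remains is the same
  -- sum for `f ∘ suc`.
  product f (suc k) = trans (cong₂ ℤ._+_ (ℤ.*-zeroʳ (f 0)) (product (f ∘ suc) k)) (ℤ.+-identityˡ _)

-- Order, rank and atoms in a finite poset.

module _ {n} {_≤_ : Rel (Fin n) 0ℓ} {O : IsDecPartialOrder _≡_ _≤_} where

  open IsDecPartialOrder O using (_≤?_; isPartialOrder; antisym)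
    renaming (refl to ≤-refl; trans to ≤-trans; reflexive to ≤-reflexive)
  open ToStrict _≡_ _≤_ using (_<_)

  infix 4 _≺?_
  _≺?_ : ∀ x y → Dec (x < y)
  _≺?_ = _<?_ {O = O}

  <⇒≤ : ∀ {x y} → x < y → x ≤ y
  <⇒≤ = proj₁

  <-≤-trans : ∀ {x y z} → x < y → y ≤ z → x < z
  <-≤-trans (x≤y , x≢y) y≤z = ≤-trans x≤y y≤z , λ { refl → x≢y (antisym x≤y y≤z) }

  <⇒≱ : ∀ {x y} → x < y → ¬ (y ≤ x)
  <⇒≱ (x≤y , x≢y) y≤x = x≢y (antisym x≤y y≤x)

  maximal : {S : Pred (Fin n) 0ℓ} → Decidable S → ∀ {x} → S x →
            ∃ λ m → S m × x ≤ m × (∀ {y} → S y → m ≤ y → y ≡ m)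
  maximal {S} S? {x} sx = go x sx (po-noetherian isPartialOrder x)
    where
    go : ∀ x → S x → Acc (λ a b → b < a) x →
         ∃ λ m → S m × x ≤ m × (∀ {y} → S y → m ≤ y → y ≡ m)
    go x sx (acc rs) with any? (λ y → S? y ×-dec x ≺? y)
    ... | yes (y , sy , x<y) with m , sm , y≤m , max ← go y sy (rs x<y) =
      m , sm , ≤-trans (<⇒≤ x<y) y≤m , max
    ... | no none = x , sx , ≤-refl , λ {y} sy x≤y → top y sy x≤y
      where
      top : ∀ y → S y → x ≤ y → y ≡ x
      top y sy x≤y with y ≟ x
      ... | yes eq = eq
      ... | no y≢x = contradiction (y , sy , x≤y , y≢x ∘ sym) none

  minimal : {S : Pred (Fin n) 0ℓ} → Decidable S → ∀ {x} → S x →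
            ∃ λ m → S m × m ≤ x × (∀ {y} → S y → y ≤ m → y ≡ m)
  minimal {S} S? {x} sx = go x sx (<-wf {O = O} x)
    where
    go : ∀ x → S x → Acc _<_ x →
         ∃ λ m → S m × m ≤ x × (∀ {y} → S y → y ≤ m → y ≡ m)
    go x sx (acc rs) with any? (λ y → S? y ×-dec y ≺? x)
    ... | yes (y , sy , y<x) with m , sm , m≤y , min ← go y sy (rs y<x) =
      m , sm , ≤-trans m≤y (<⇒≤ y<x) , min
    ... | no none = x , sx , ≤-refl , λ {y} sy y≤x → bottom y sy y≤x
      where
      bottom : ∀ y → S y → y ≤ x → y ≡ x
      bottom y sy y≤x with y ≟ x
      ... | yes eq = eq
      ... | no y≢x = contradiction (y , sy , y≤x , y≢x) none

  module _ (P : FinitePoset O) where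

    coverBelow : ∀ {x y} → x ∈ support P → y ∈ support P → x < y →
                 ∃ λ z → x ≤ z × Covers P y z
    coverBelow {x} {y} x∈ y∈ x<y
      with z , (z∈ , z<y) , x≤z , max ←
        maximal (λ z → z ∈? support P ×-dec z ≺? y) (x∈ , x<y) =
      z , x≤z , z∈ , y∈ , z<y ,
      λ w w∈ (z<w , w<y) → proj₂ z<w (sym (max (w∈ , w<y) (<⇒≤ z<w)))

    ≢0̂⇒0̂< : ∀ {x} → x ∈ support P → x ≢ 0̂ P → 0̂ P < x
    ≢0̂⇒0̂< x∈ x≢0 = 0̂-least P x∈ , x≢0 ∘ sym

    ≤0̂⇒≡0̂ : ∀ {x} → x ∈ support P → x ≤ 0̂ P → x ≡ 0̂ P
    ≤0̂⇒≡0̂ x∈ x≤0 = antisym x≤0 (0̂-least P x∈)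

    rk-mono : ∀ {x y} → x ∈ support P → x < y → rk P x ℕ.< rk P y
    rk-mono {x} {y} x∈ x<y = begin
      suc (rk P x)                          ≡⟨ given-yes (x ∈? support P ×-dec x ≺? y) (x∈ , x<y) ⟨
      below x                               ≤⟨ maximum-upper below x ⟩
      maximum below                         ≡⟨ rk-unfold P y ⟨
      rk P y                                ∎
      where
      open ℕ.≤-Reasoning
      below : Fin n → ℕ
      below z = given (z ∈? support P ×-dec z ≺? y) (λ _ → suc (rk P z)) 0

    rk-mono-≤ : ∀ {x y} → x ∈ support P → x ≤ y → rk P x ℕ.≤ rk P y
    rk-mono-≤ {x} {y} x∈ x≤y with x ≟ y
    ... | yes refl = ℕ.≤-refl
    ... | no x≢y   = ℕ.<⇒≤ (rk-mono x∈ (x≤y , x≢y))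

    rk-attained : ∀ y → rk P y ≡ 0 ⊎ (∃ λ x → x ∈ support P × x < y × rk P y ≡ suc (rk P x))
    rk-attained y with maximum-attained
      (λ z → given (z ∈? support P ×-dec z ≺? y) (λ _ → suc (rk P z)) 0)
    ... | inj₁ eq = inj₁ (trans (rk-unfold P y) eq)
    ... | inj₂ (x , eq) with given-cases (x ∈? support P ×-dec x ≺? y)
    ...   | inj₁ ((x∈ , x<y) , eqᵢ) = inj₂ (x , x∈ , x<y , trans (rk-unfold P y) (trans eq eqᵢ))
    ...   | inj₂ (_ , eqᵢ)          = inj₁ (trans (rk-unfold P y) (trans eq eqᵢ))

    -- Strict monotonicity bounds `rk` by `ρ`, and a descent by exactly one bounds `ρ` by `rk`.
    -- Ranks in subposets and under isomorphisms are computed by this criterion.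
    rk-unique : (ρ : Fin n → ℕ) →
      (∀ {x y} → x ∈ support P → y ∈ support P → x < y → ρ x ℕ.< ρ y) →
      (∀ {y} → y ∈ support P → ρ y ≡ 0 ⊎ (∃ λ x → x ∈ support P × x < y × ρ y ≡ suc (ρ x))) →
      ∀ {x} → x ∈ support P → rk P x ≡ ρ x
    rk-unique ρ mono attained {x} x∈ = go x x∈ (<-wf {O = O} x)
      where
      go : ∀ x → x ∈ support P → Acc _<_ x → rk P x ≡ ρ x
      go y y∈ (acc rs) = ℕ.≤-antisym ≤ρ ρ≤
        where
        ≤ρ : rk P y ℕ.≤ ρ y
        ≤ρ with rk-attained y
        ... | inj₁ eq rewrite eq = z≤n
        ... | inj₂ (x , x∈ , x<y , eq) rewrite eq | go x x∈ (rs x<y) = mono x∈ y∈ x<y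
        ρ≤ : ρ y ℕ.≤ rk P y
        ρ≤ with attained y∈
        ... | inj₁ eq rewrite eq = z≤n
        ... | inj₂ (x , x∈ , x<y , eq) rewrite eq | sym (go x x∈ (rs x<y)) = rk-mono x∈ x<y

    rk-0̂ : rk P (0̂ P) ≡ 0
    rk-0̂ with rk-attained (0̂ P)
    ... | inj₁ eq                 = eq
    ... | inj₂ (x , x∈ , x<0 , _) = contradiction (0̂-least P x∈) (<⇒≱ x<0)

    rk≡0⇒≡0̂ : ∀ {x} → x ∈ support P → rk P x ≡ 0 → x ≡ 0̂ P
    rk≡0⇒≡0̂ {x} x∈ eq with x ≟ 0̂ P
    ... | yes x≡0 = x≡0
    ... | no x≢0  = contradiction (rk-mono (0̂∈ P) (≢0̂⇒0̂< x∈ x≢0))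
      (subst (λ k → ¬ (_ ℕ.< k)) (sym eq) λ ())

    rank-upper : ∀ {x} → x ∈ support P → rk P x ℕ.≤ rank P
    rank-upper {x} x∈ = subst (ℕ._≤ rank P) (given-yes (x ∈? support P) x∈)
      (maximum-upper (λ x → given (x ∈? support P) (λ _ → rk P x) 0) x)

    rank-attained : ∃ λ x → x ∈ support P × rank P ≡ rk P x
    rank-attained with maximum-attained (λ x → given (x ∈? support P) (λ _ → rk P x) 0)
    ... | inj₁ eq = 0̂ P , 0̂∈ P , trans eq (sym rk-0̂)
    ... | inj₂ (x , eq) with given-cases (x ∈? support P)
    ...   | inj₁ (x∈ , eqᵢ) = x , x∈ , trans eq eqᵢ
    ...   | inj₂ (_ , eqᵢ)  = 0̂ P , 0̂∈ P , trans eq (trans eqᵢ (sym rk-0̂))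

    atom⇒≢0̂ : ∀ {a} → IsAtom P a → a ≢ 0̂ P
    atom⇒≢0̂ (_ , rk≡1) refl with () ← trans (sym rk-0̂) rk≡1

    below-atom : ∀ {a x} → IsAtom P a → x ∈ support P → x ≤ a → x ≡ 0̂ P ⊎ x ≡ a
    below-atom {a} {x} (a∈ , rk≡1) x∈ x≤a with x ≟ a
    ... | yes x≡a = inj₂ x≡a
    ... | no x≢a  = inj₁ (rk≡0⇒≡0̂ x∈
      (ℕ.n≤0⇒n≡0 (ℕ.s≤s⁻¹ (subst (rk P x ℕ.<_) rk≡1 (rk-mono x∈ (x≤a , x≢a))))))

    maximalAbove : ∀ {x} → x ∈ support P → ∃ λ m → Maximal P m × x ≤ m
    maximalAbove x∈ with m , m∈ , x≤m , max ← maximal (_∈? support P) x∈ =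
      m , (m∈ , λ y → max) , x≤m

  -- This serves subposets that are not order ideals: the descent by one rank of `P` has to happen
  -- inside `Q`.
  rk-agree : (P Q : FinitePoset O) → support Q ⊆ support P →
    (∀ {y} → y ∈ support Q → y ≢ 0̂ Q → ∃ λ x → x ∈ support Q × x < y × rk P y ≡ suc (rk P x)) →
    0̂ Q ≡ 0̂ P → ∀ {x} → x ∈ support Q → rk Q x ≡ rk P x
  rk-agree P Q Q⊆P descend 0≡ = rk-unique Q (rk P) (λ x∈ _ → rk-mono P (Q⊆P x∈)) attained
    where
    attained : ∀ {y} → y ∈ support Q →
      rk P y ≡ 0 ⊎ (∃ λ x → x ∈ support Q × x < y × rk P y ≡ suc (rk P x))
    attained {y} y∈ with y ≟ 0̂ Q
    ... | yes refl = inj₁ (trans (cong (rk P) 0≡) (rk-0̂ P))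
    ... | no y≢0   = inj₂ (descend y∈ y≢0)

  rk-ideal : (P Q : FinitePoset O) → support Q ⊆ support P →
    (∀ {x y} → x ∈ support P → y ∈ support Q → x ≤ y → x ∈ support Q) →
    ∀ {x} → x ∈ support Q → rk Q x ≡ rk P x
  rk-ideal P Q Q⊆P down = rk-unique Q (rk P) (λ x∈ _ → rk-mono P (Q⊆P x∈)) attained
    where
    attained : ∀ {y} → y ∈ support Q →
      rk P y ≡ 0 ⊎ (∃ λ x → x ∈ support Q × x < y × rk P y ≡ suc (rk P x))
    attained {y} y∈ with rk-attained P y
    ... | inj₁ eq                   = inj₁ eq
    ... | inj₂ (x , x∈ , x<y , eq) = inj₂ (x , down x∈ y∈ (<⇒≤ x<y) , x<y , eq)

  -- Local joins, meets and the geometric axioms.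

  module _ (P : FinitePoset O) where

    -- Two elements may have several minimal upper bounds in a locally geometric poset, but only one
    -- below a given common upper bound `t`. Meets carry no such bound, since all lower bounds of
    -- `x` already lie in one lattice.
    record JoinBelow (t x y j : Fin n) : Set where
      field
        j∈    : j ∈ support P
        left  : x ≤ j
        right : y ≤ j
        j≤t   : j ≤ t
        least : ∀ {v} → v ∈ support P → x ≤ v → y ≤ v → v ≤ t → j ≤ v

    record Meet (x y w : Fin n) : Set where
      field
        w∈       : w ∈ support P
        left     : w ≤ x
        right    : w ≤ y
        greatest : ∀ {v} → v ∈ support P → v ≤ x → v ≤ y → v ≤ w

    -- A form of LocallyGeometric that mentions neither chains nor lattice operations.
    record LocalAxioms : Set where
      field
        graded     : ∀ {x y} → Covers P y x → rk P y ≡ suc (rk P x)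
        join       : ∀ {t x y} → t ∈ support P → x ∈ support P → y ∈ support P →
                     x ≤ t → y ≤ t → ∃ (JoinBelow t x y)
        atomBelow  : ∀ {x y} → Covers P y x → ∃ λ a → IsAtom P a × a ≤ y × ¬ (a ≤ x)
        joinCovers : ∀ {x a j} → x ∈ support P → IsAtom P a → ¬ (a ≤ x) →
                     JoinBelow j x a j → Covers P j x

      atomBelow-< : ∀ {x y} → x ∈ support P → y ∈ support P → x < y →
                    ∃ λ a → IsAtom P a × a ≤ y × ¬ (a ≤ x)
      atomBelow-< x∈ y∈ x<y with z , x≤z , cov ← coverBelow P x∈ y∈ x<y
        with a , atom , a≤y , a≰z ← atomBelow cov =
        a , atom , a≤y , λ a≤x → a≰z (≤-trans a≤x x≤z)

      -- Take a maximal common lower bound `w`. Its join below `t` with any other common lower bound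
      -- `v` is again below `x` and `y`, hence equals `w`, and so `v ≤ w`.
      meet : ∀ {t x y} → t ∈ support P → x ∈ support P → y ∈ support P →
             x ≤ t → y ≤ t → ∃ (Meet x y)
      meet {t} {x} {y} t∈ x∈ y∈ x≤t y≤t
        with w , (w∈ , w≤x , w≤y) , _ , max ← maximal
          (λ w → w ∈? support P ×-dec w ≤? x ×-dec w ≤? y)
          (0̂∈ P , 0̂-least P x∈ , 0̂-least P y∈) =
        w , record { w∈ = w∈ ; left = w≤x ; right = w≤y ; greatest = greatest }
        where
        greatest : ∀ {v} → v ∈ support P → v ≤ x → v ≤ y → v ≤ w
        greatest {v} v∈ v≤x v≤y
          with j , J ← join t∈ v∈ w∈ (≤-trans v≤x x≤t) (≤-trans w≤x x≤t) =
          subst (v ≤_)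
            (max (j∈ , least x∈ v≤x w≤x x≤t , least y∈ v≤y w≤y y≤t) right) left
          where open JoinBelow J

  -- The bound `t` only selects one of the minimal upper bounds; once `j` is known, it can itself
  -- play the part of the bound.
  shrink : ∀ {P : FinitePoset O} {t x y j} → JoinBelow P t x y j → JoinBelow P j x y j
  shrink J = record
    { j∈ = j∈ ; left = left ; right = right ; j≤t = ≤-refl
    ; least = λ v∈ x≤v y≤v v≤j → least v∈ x≤v y≤v (≤-trans v≤j j≤t) }
    where open JoinBelow J

  -- Lower intervals and maximal chains.

  module _ (P : FinitePoset O) where

    ∈-↓⁺ : ∀ t {x} → x ∈ support P → x ≤ proj₁ t → x ∈ support (_↓_ P t)
    ∈-↓⁺ t x∈ x≤t = ∈⟪⟫⁺ (below? P (proj₁ t)) (x∈ , x≤t)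

    ∈-↓⁻ : ∀ t {x} → x ∈ support (_↓_ P t) → x ∈ support P × x ≤ proj₁ t
    ∈-↓⁻ t = ∈⟪⟫⁻ (below? P (proj₁ t))

    rk-↓ : ∀ t {x} → x ∈ support (_↓_ P t) → rk (_↓_ P t) x ≡ rk P x
    rk-↓ t = rk-ideal P (_↓_ P t) (proj₁ ∘ ∈-↓⁻ t) λ x∈ y∈ x≤y →
      ∈-↓⁺ t x∈ (≤-trans x≤y (proj₂ (∈-↓⁻ t y∈)))

    covers-↓⁺ : ∀ t {x y} → y ≤ proj₁ t → Covers P y x → Covers (_↓_ P t) y x
    covers-↓⁺ t y≤t (x∈ , y∈ , x<y , none) =
      ∈-↓⁺ t x∈ (≤-trans (<⇒≤ x<y) y≤t) , ∈-↓⁺ t y∈ y≤t , x<y , λ z z∈ → none z (proj₁ (∈-↓⁻ t z∈))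

    covers-↓⁻ : ∀ t {x y} → Covers (_↓_ P t) y x → Covers P y x
    covers-↓⁻ t (x∈ , y∈ , x<y , none) =
      proj₁ (∈-↓⁻ t x∈) , proj₁ (∈-↓⁻ t y∈) , x<y , λ z z∈ (x<z , z<y) →
        none z (∈-↓⁺ t z∈ (≤-trans (<⇒≤ z<y) (proj₂ (∈-↓⁻ t y∈)))) (x<z , z<y)

    insert-isChain : ∀ {z C} → IsChain P C → z ∈ support P →
                     (∀ {y} → y ∈ C → y ≤ z ⊎ z ≤ y) → IsChain P (C ∪ ⁅ z ⁆)
    insert-isChain {z} {C} (C⊆ , chain) z∈ comparable = sub , chain′
      where
      sub : C ∪ ⁅ z ⁆ ⊆ support P
      sub y∈ with ∈∪⁅⁆⁻ y∈
      ... | inj₁ y∈C  = C⊆ y∈C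
      ... | inj₂ refl = z∈
      chain′ : ∀ u v → u ∈ C ∪ ⁅ z ⁆ → v ∈ C ∪ ⁅ z ⁆ → u ≤ v ⊎ v ≤ u
      chain′ u v u∈ v∈ with ∈∪⁅⁆⁻ u∈ | ∈∪⁅⁆⁻ v∈
      ... | inj₁ u∈C  | inj₁ v∈C  = chain u v u∈C v∈C
      ... | inj₁ u∈C  | inj₂ refl = comparable u∈C
      ... | inj₂ refl | inj₂ refl = inj₁ ≤-refl
      ... | inj₂ refl | inj₁ v∈C with comparable v∈C
      ...   | inj₁ v≤z = inj₂ v≤z
      ...   | inj₂ z≤v = inj₁ z≤v

    insert-below : ∀ {x z C} → ChainWithTop P x C → z ∈ support P → z ≤ x →
                   (∀ {y} → y ∈ C → y ≤ z ⊎ z ≤ y) → ChainWithTop P x (C ∪ ⁅ z ⁆)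
    insert-below {x} {z} {C} (isChain , x∈C , top) z∈ z≤x comparable =
      insert-isChain isChain z∈ comparable , p⊆p∪⁅x⁆ x∈C , top′
      where
      top′ : ∀ y → y ∈ C ∪ ⁅ z ⁆ → y ≤ x
      top′ y y∈ with ∈∪⁅⁆⁻ y∈
      ... | inj₁ y∈C  = top y y∈C
      ... | inj₂ refl = z≤x

    insert-top : ∀ {x y C} → ChainWithTop P x C → y ∈ support P → x ≤ y →
                 ChainWithTop P y (C ∪ ⁅ y ⁆)
    insert-top {x} {y} {C} (isChain , x∈C , top) y∈ x≤y =
      insert-isChain isChain y∈ (λ z∈ → inj₁ (≤-trans (top _ z∈) x≤y)) , x∈p∪⁅x⁆ , top′
      where
      top′ : ∀ z → z ∈ C ∪ ⁅ y ⁆ → z ≤ y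
      top′ z z∈ with ∈∪⁅⁆⁻ z∈
      ... | inj₁ z∈C  = ≤-trans (top z z∈C) x≤y
      ... | inj₂ refl = ≤-refl

    -- In a larger chain with top `y`, every element other than `y` is below `x`, as nothing lies
    -- strictly between. These elements form a chain with top `x` containing `C`, so maximality of
    -- `C` applies.
    insert-maximal : ∀ {x y C} → Covers P y x → MaximalChainWithTop P x C →
                     MaximalChainWithTop P y (C ∪ ⁅ y ⁆)
    insert-maximal {x} {y} {C} (x∈ , y∈ , x<y , none) (cwt@(_ , x∈C , top) , max) =
      insert-top cwt y∈ (<⇒≤ x<y) , max′
      where
      max′ : ∀ D → ChainWithTop P y D → C ∪ ⁅ y ⁆ ⊆ D → D ⊆ C ∪ ⁅ y ⁆
      max′ D ((D⊆ , chainD) , y∈D , topD) C⊆D {d} d∈ with d ≟ y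
      ... | yes refl = x∈p∪⁅x⁆
      ... | no d≢y   = p⊆p∪⁅x⁆ (max ⟪ D≤x? ⟫ below-x C⊆D≤x (∈⟪⟫⁺ D≤x? (d∈ , d≤x)))
        where
        D≤x? : Decidable (λ z → z ∈ D × z ≤ x)
        D≤x? z = z ∈? D ×-dec z ≤? x
        C⊆D≤x : C ⊆ ⟪ D≤x? ⟫
        C⊆D≤x z∈ = ∈⟪⟫⁺ D≤x? (C⊆D (p⊆p∪⁅x⁆ z∈) , top _ z∈)
        below-x : ChainWithTop P x ⟪ D≤x? ⟫
        below-x = (D⊆ ∘ proj₁ ∘ ∈⟪⟫⁻ D≤x? ,
                   λ u v u∈ v∈ → chainD u v (proj₁ (∈⟪⟫⁻ D≤x? u∈)) (proj₁ (∈⟪⟫⁻ D≤x? v∈))) ,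
                  C⊆D≤x x∈C , λ z z∈ → proj₂ (∈⟪⟫⁻ D≤x? z∈)
        d≤x : d ≤ x
        d≤x with chainD d x d∈ (C⊆D (p⊆p∪⁅x⁆ x∈C))
        ... | inj₁ d≤x = d≤x
        ... | inj₂ x≤d with d ≟ x
        ...   | yes refl = ≤-refl
        ...   | no d≢x   = contradiction ((x≤d , d≢x ∘ sym) , topD d d∈ , d≢y) (none d (D⊆ d∈))

    maximalChain : ∀ {x} → x ∈ support P → ∃ (MaximalChainWithTop P x)
    maximalChain {x} x∈ = go x x∈ (<-wf {O = O} x)
      where
      go : ∀ x → x ∈ support P → Acc _<_ x → ∃ (MaximalChainWithTop P x)
      go x x∈ (acc rs) with x ≟ 0̂ P
      ... | no x≢0 with y , _ , cov ← coverBelow P (0̂∈ P) x∈ (≢0̂⇒0̂< P x∈ x≢0)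
        with C , max ← go y (proj₁ cov) (rs (proj₁ (proj₂ (proj₂ cov)))) =
        C ∪ ⁅ x ⁆ , insert-maximal cov max
      go _ _ _ | yes refl = ⁅ 0̂ P ⁆ ,
        (((λ z∈ → subst (_∈ support P) (sym (is0 z∈)) (0̂∈ P)) ,
          λ u v u∈ v∈ → inj₁ (≤-reflexive (trans (is0 u∈) (sym (is0 v∈))))) ,
         x∈⁅x⁆ (0̂ P) , λ z z∈ → ≤-reflexive (is0 z∈)) ,
        λ D ((D⊆ , _) , _ , topD) _ {d} d∈ →
          subst (_∈ ⁅ 0̂ P ⁆) (sym (≤0̂⇒≡0̂ P (D⊆ d∈) (topD d d∈))) (x∈⁅x⁆ (0̂ P))
        where
        is0 : ∀ {z} → z ∈ ⁅ 0̂ P ⁆ → z ≡ 0̂ P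
        is0 = x∈⁅y⁆⇒x≡y (0̂ P)

    -- Adding `y` to a maximal chain with top `x` gives a maximal chain with one more element;
    -- rankedness converts both sizes into ranks.
    ranked⇒graded : Ranked P → ∀ {x y} → Covers P y x → rk P y ≡ suc (rk P x)
    ranked⇒graded ranked {x} {y} cov@(x∈ , _ , x<y , _)
      with C , max ← maximalChain x∈ = ℕ.suc-injective (begin
      suc (rk P y)       ≡⟨ ranked y (C ∪ ⁅ y ⁆) (insert-maximal cov max) ⟨
      ∣ C ∪ ⁅ y ⁆ ∣      ≡⟨ ∣p∪⁅x⁆∣ C y (λ y∈C → <⇒≱ x<y (proj₂ (proj₂ (proj₁ max)) y y∈C)) ⟩
      suc ∣ C ∣          ≡⟨ cong suc (ranked x C max) ⟩
      suc (suc (rk P x)) ∎)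
      where open ≡-Reasoning

    -- Remove the top `x` of a maximal chain. An element between the new top `z` and `x` could be
    -- inserted, so `x` covers `z`, and the shorter chain is again maximal. Each removal lowers size
    -- and rank by one.
    graded⇒ranked : (∀ {x y} → Covers P y x → rk P y ≡ suc (rk P x)) → Ranked P
    graded⇒ranked graded x C = go x C (<-wf {O = O} x)
      where
      go : ∀ x C → Acc _<_ x → MaximalChainWithTop P x C → ∣ C ∣ ≡ suc (rk P x)
      go x C (acc rs) (cwt@((C⊆ , chain) , x∈C , top) , max) with x ≟ 0̂ P
      ... | yes refl = trans (cong ∣_∣ (⊆-antisym C⊆0 0⊆C))
        (trans (∣⁅x⁆∣≡1 (0̂ P)) (cong suc (sym (rk-0̂ P))))
        where
        C⊆0 : C ⊆ ⁅ 0̂ P ⁆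
        C⊆0 {z} z∈ = subst (_∈ ⁅ 0̂ P ⁆) (sym (≤0̂⇒≡0̂ P (C⊆ z∈) (top z z∈))) (x∈⁅x⁆ (0̂ P))
        0⊆C : ⁅ 0̂ P ⁆ ⊆ C
        0⊆C z∈ = subst (_∈ C) (sym (x∈⁅y⁆⇒x≡y (0̂ P) z∈)) x∈C
      -- Maximality forces `0̂` into the chain, so `C - x` is nonempty and has a top.
      ... | no x≢0 with 0∈C ← max (C ∪ ⁅ 0̂ P ⁆)
            (insert-below cwt (0̂∈ P) (0̂-least P (C⊆ x∈C)) (inj₂ ∘ 0̂-least P ∘ C⊆)) p⊆p∪⁅x⁆ x∈p∪⁅x⁆
        with z , z∈- , _ , zmax ← maximal (_∈? (C - x)) (x∈p∧x≢y⇒x∈p-y 0∈C (x≢0 ∘ sym))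
        with z∈C ← ∈-⇒∈ z∈- = begin
        ∣ C ∣               ≡⟨ cong ∣_∣ (p-x∪⁅x⁆≡p x∈C) ⟨
        ∣ (C - x) ∪ ⁅ x ⁆ ∣ ≡⟨ ∣p∪⁅x⁆∣ (C - x) x (x∉p-x C x) ⟩
        suc ∣ C - x ∣       ≡⟨ cong suc (go z (C - x) (rs z<x) (cwt- , max-)) ⟩
        suc (suc (rk P z))  ≡⟨ cong suc (graded (C⊆ z∈C , C⊆ x∈C , z<x , none)) ⟨
        suc (rk P x)        ∎
        where
        open ≡-Reasoning
        z<x : z < x
        z<x = top z z∈C , ∈-⇒≢ z∈-
        top- : ∀ y → y ∈ C - x → y ≤ z
        top- y y∈ with chain y z (∈-⇒∈ y∈) z∈C
        ... | inj₁ y≤z = y≤z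
        ... | inj₂ z≤y = ≤-reflexive (zmax y∈ z≤y)
        cwt- : ChainWithTop P z (C - x)
        cwt- = (C⊆ ∘ ∈-⇒∈ , λ u v u∈ v∈ → chain u v (∈-⇒∈ u∈) (∈-⇒∈ v∈)) , z∈- , top-
        none : ∀ w → w ∈ support P → ¬ (z < w × w < x)
        none w w∈ (z<w , w<x) = proj₂ z<w (sym (zmax (x∈p∧x≢y⇒x∈p-y w∈C (proj₂ w<x)) (<⇒≤ z<w)))
          where
          comparable : ∀ {y} → y ∈ C → y ≤ w ⊎ w ≤ y
          comparable {y} y∈ with y ≟ x
          ... | yes refl = inj₂ (<⇒≤ w<x)
          ... | no y≢x   = inj₁ (≤-trans (top- y (x∈p∧x≢y⇒x∈p-y y∈ y≢x)) (<⇒≤ z<w))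
          w∈C : w ∈ C
          w∈C = max (C ∪ ⁅ w ⁆) (insert-below cwt w∈ (<⇒≤ w<x) comparable)
                  p⊆p∪⁅x⁆ x∈p∪⁅x⁆
        max- : ∀ D → ChainWithTop P z D → C - x ⊆ D → D ⊆ C - x
        max- D cwtD@(_ , _ , topD) C⊆D {d} d∈ =
          x∈p∧x≢y⇒x∈p-y (max (D ∪ ⁅ x ⁆) (insert-top cwtD (C⊆ x∈C) (<⇒≤ z<x)) C⊆D+x (p⊆p∪⁅x⁆ d∈)) d≢x
          where
          d≢x : d ≢ x
          d≢x refl = <⇒≱ z<x (topD d d∈)
          C⊆D+x : C ⊆ D ∪ ⁅ x ⁆
          C⊆D+x {y} y∈ with y ≟ x
          ... | yes refl = x∈p∪⁅x⁆
          ... | no y≢x   = p⊆p∪⁅x⁆ (C⊆D (x∈p∧x≢y⇒x∈p-y y∈ y≢x))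

  -- Two descriptions of locally geometric posets.

  module _ (P : FinitePoset O) where

    -- `atomBelow` and `joinCovers` are the two directions of `geometric`, read in the interval
    -- below the upper element of the cover, whose top is that element itself.
    locallyGeometric⇒axioms : LocallyGeometric P → LocalAxioms P
    locallyGeometric⇒axioms lg = record
      { graded = ranked⇒graded P ranked ; join = join
      ; atomBelow = atomBelow ; joinCovers = joinCovers }
      where
      open LocallyGeometric lg
      join : ∀ {t x y} → t ∈ support P → x ∈ support P → y ∈ support P →
             x ≤ t → y ≤ t → ∃ (JoinBelow P t x y)
      join {t} {x} {y} t∈ x∈ y∈ x≤t y≤t = proj₁ j , record
        { j∈ = proj₁ (∈-↓⁻ P (t , t∈) (proj₂ j)) ; left = x≤x∨y x′ y′ ; right = y≤x∨y x′ y′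
        ; j≤t = proj₂ (∈-↓⁻ P (t , t∈) (proj₂ j))
        ; least = λ v∈ x≤v y≤v v≤t →
            ∨-least {x′} {y′} {_ , ∈-↓⁺ P (t , t∈) v∈ v≤t} x≤v y≤v }
        where
        open GeometricLattice (local (t , t∈))
        open IsLattice isLattice using (x≤x∨y; y≤x∨y; ∨-least)
        x′ y′ j : Element (_↓_ P (t , t∈))
        x′ = x , ∈-↓⁺ P (t , t∈) x∈ x≤t
        y′ = y , ∈-↓⁺ P (t , t∈) y∈ y≤t
        j = x′ ∨ y′
      atomBelow : ∀ {x y} → Covers P y x → ∃ λ a → IsAtom P a × a ≤ y × ¬ (a ≤ x)
      atomBelow {x} {y} cov@(x∈ , y∈ , x<y , _)
        with (a , a∈) , (_ , rk≡1) , a≰x , _ ← Equivalence.to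
          (GeometricLattice.geometric (local (y , y∈))
            (x , ∈-↓⁺ P (y , y∈) x∈ (<⇒≤ x<y)) (y , ∈-↓⁺ P (y , y∈) y∈ ≤-refl))
          (covers-↓⁺ P (y , y∈) ≤-refl cov)
        with a∈P , a≤y ← ∈-↓⁻ P (y , y∈) a∈ =
        a , (a∈P , trans (sym (rk-↓ P (y , y∈) a∈)) rk≡1) , a≤y , a≰x
      joinCovers : ∀ {x a j} → x ∈ support P → IsAtom P a → ¬ (a ≤ x) →
                   JoinBelow P j x a j → Covers P j x
      joinCovers {x} {a} {j} x∈ (a∈ , rk≡1) a≰x J = covers-↓⁻ P t (Equivalence.from
        (geometric x′ (j , j∈t))
        (a′ , (proj₂ a′ , trans (rk-↓ P t (proj₂ a′)) rk≡1) , a≰x ,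
         antisym (least (proj₁ (∈-↓⁻ P t (proj₂ (x′ ∨ a′)))) (x≤x∨y x′ a′) (y≤x∨y x′ a′)
                   (proj₂ (∈-↓⁻ P t (proj₂ (x′ ∨ a′)))))
           (∨-least {x′} {a′} {j , j∈t} left right)))
        where
        open JoinBelow J
        t : Element P
        t = j , j∈
        open GeometricLattice (local t)
        open IsLattice isLattice using (x≤x∨y; y≤x∨y; ∨-least)
        x′ a′ : Element (_↓_ P t)
        x′ = x , ∈-↓⁺ P t x∈ left
        a′ = a , ∈-↓⁺ P t a∈ right
        j∈t : j ∈ support (_↓_ P t)
        j∈t = ∈-↓⁺ P t j∈ ≤-refl

    axioms⇒locallyGeometric : LocalAxioms P → LocallyGeometric P
    axioms⇒locallyGeometric ax = record { ranked = graded⇒ranked P graded ; local = local }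
      where
      open LocalAxioms ax
      local : ∀ t → GeometricLattice (_↓_ P t)
      local t@(t₀ , t∈) = record
        { _∨_ = _∨_ ; _∧_ = _∧_
        ; isLattice = record
          { isPartialOrder = On.isPartialOrder proj₁ isPartialOrder
          ; supremum = λ x y → JoinBelow.left (sup x y) , JoinBelow.right (sup x y) ,
              λ z x≤z y≤z → JoinBelow.least (sup x y)
                (proj₁ (∈-↓⁻ P t (proj₂ z))) x≤z y≤z (proj₂ (∈-↓⁻ P t (proj₂ z)))
          ; infimum = λ x y → Meet.left (inf x y) , Meet.right (inf x y) ,
              λ z z≤x z≤y → Meet.greatest (inf x y) (proj₁ (∈-↓⁻ P t (proj₂ z))) z≤x z≤y
          }
        ; geometric = λ x y → mk⇔ (to x y) (from x y)
        }
        where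
        join′ : ∀ (x y : Element (_↓_ P t)) → ∃ (JoinBelow P t₀ (proj₁ x) (proj₁ y))
        join′ (x , x∈) (y , y∈) with x∈P , x≤t ← ∈-↓⁻ P t x∈ | y∈P , y≤t ← ∈-↓⁻ P t y∈ =
          join t∈ x∈P y∈P x≤t y≤t
        meet′ : ∀ (x y : Element (_↓_ P t)) → ∃ (Meet P (proj₁ x) (proj₁ y))
        meet′ (x , x∈) (y , y∈) with x∈P , x≤t ← ∈-↓⁻ P t x∈ | y∈P , y≤t ← ∈-↓⁻ P t y∈ =
          meet t∈ x∈P y∈P x≤t y≤t
        _∨_ _∧_ : Element (_↓_ P t) → Element (_↓_ P t) → Element (_↓_ P t)
        x ∨ y = proj₁ (join′ x y) ,
          ∈-↓⁺ P t (JoinBelow.j∈ (proj₂ (join′ x y))) (JoinBelow.j≤t (proj₂ (join′ x y)))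
        x ∧ y = proj₁ (meet′ x y) , ∈-↓⁺ P t (Meet.w∈ (proj₂ (meet′ x y)))
          (≤-trans (Meet.left (proj₂ (meet′ x y))) (proj₂ (∈-↓⁻ P t (proj₂ x))))
        sup : ∀ x y → JoinBelow P t₀ (proj₁ x) (proj₁ y) (proj₁ (x ∨ y))
        sup x y = proj₂ (join′ x y)
        inf : ∀ x y → Meet P (proj₁ x) (proj₁ y) (proj₁ (x ∧ y))
        inf x y = proj₂ (meet′ x y)
        to : ∀ x y → Covers (_↓_ P t) (proj₁ y) (proj₁ x) →
             ∃ λ a → IsAtom (_↓_ P t) (proj₁ a) × ¬ (proj₁ a ≤ proj₁ x) × proj₁ y ≡ proj₁ (x ∨ a)
        to (x , x∈) (y , y∈) cov with a , (a∈ , rk≡1) , a≤y , a≰x ← atomBelow (covers-↓⁻ P t cov) =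
          a′ , (proj₂ a′ , trans (rk-↓ P t (proj₂ a′)) rk≡1) , a≰x , eq
          where
          a′ : Element (_↓_ P t)
          a′ = a , ∈-↓⁺ P t a∈ (≤-trans a≤y (proj₂ (∈-↓⁻ P t y∈)))
          open JoinBelow (sup (x , x∈) a′)
          j : Fin n
          j = proj₁ ((x , x∈) ∨ a′)
          x<j : x < j
          x<j = left , λ x≡j → a≰x (subst (a ≤_) (sym x≡j) right)
          j≤y : j ≤ y
          j≤y = let _ , _ , x<y , _ = cov in
            least (proj₁ (∈-↓⁻ P t y∈)) (<⇒≤ x<y) a≤y (proj₂ (∈-↓⁻ P t y∈))
          eq : y ≡ j
          eq with j ≟ y
          ... | yes j≡y = sym j≡y
          ... | no j≢y  = let _ , _ , _ , none = covers-↓⁻ P t cov in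
            contradiction (x<j , j≤y , j≢y) (none j j∈)
        from : ∀ x y →
          (∃ λ a → IsAtom (_↓_ P t) (proj₁ a) × ¬ (proj₁ a ≤ proj₁ x) × proj₁ y ≡ proj₁ (x ∨ a)) →
          Covers (_↓_ P t) (proj₁ y) (proj₁ x)
        from x (_ , y∈) (a@(_ , a∈) , (_ , rk≡1) , a≰x , refl) =
          covers-↓⁺ P t j≤t (joinCovers (proj₁ (∈-↓⁻ P t (proj₂ x)))
            (proj₁ (∈-↓⁻ P t a∈) , trans (sym (rk-↓ P t a∈)) rk≡1) a≰x (shrink (sup x a)))
          where open JoinBelow (sup x a)

  -- Joins as sets of minimal upper bounds.

  module _ (P : FinitePoset O) where

    ∈-⋁⁺ : ∀ {T u} → MinimalUpperBound P T u → u ∈ ⋁ P T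
    ∈-⋁⁺ {T} = ∈⟪⟫⁺ (minimalUpperBound? P T)

    ∈-⋁⁻ : ∀ {T u} → u ∈ ⋁ P T → MinimalUpperBound P T u
    ∈-⋁⁻ {T} = ∈⟪⟫⁻ (minimalUpperBound? P T)

    pair-bound : ∀ {x y v} → v ∈ support P → x ≤ v → y ≤ v → UpperBound P (⁅ x ⁆ ∪ ⁅ y ⁆) v
    pair-bound {x} {y} {v} v∈ x≤v y≤v = v∈ , bound
      where
      bound : ∀ t → t ∈ ⁅ x ⁆ ∪ ⁅ y ⁆ → t ≤ v
      bound t t∈ with ∈∪⁅⁆⁻ t∈
      ... | inj₂ refl = y≤v
      ... | inj₁ t∈x with refl ← x∈⁅y⁆⇒x≡y x t∈x = x≤v

    bound-pair : ∀ {x y v} → UpperBound P (⁅ x ⁆ ∪ ⁅ y ⁆) v → v ∈ support P × x ≤ v × y ≤ v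
    bound-pair {x} {y} (v∈ , bound) = v∈ , bound x (p⊆p∪⁅x⁆ (x∈⁅x⁆ x)) , bound y x∈p∪⁅x⁆

    -- An upper bound under `j` is also under `t`, so leastness below `t` gives minimality in all of
    -- `P`.
    joinBelow⇒∈⋁ : ∀ {t x y j} → JoinBelow P t x y j → j ∈ _∨ˢ_ P x y
    joinBelow⇒∈⋁ J = ∈-⋁⁺ (pair-bound j∈ left right , λ v bound v≤j →
      let v∈ , x≤v , y≤v = bound-pair bound
      in antisym v≤j (least v∈ x≤v y≤v (≤-trans v≤j j≤t)))
      where open JoinBelow J

  record Join (P : FinitePoset O) (x y j : Fin n) : Set where
    field
      j∈    : j ∈ support P
      left  : x ≤ j
      right : y ≤ j
      least : ∀ {v} → v ∈ support P → x ≤ v → y ≤ v → j ≤ v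

  -- Every upper bound lies above a minimal one, and there is only one of these.
  unique∨⇒join : ∀ (P : FinitePoset O) {x y} → ∣ _∨ˢ_ P x y ∣ ≡ 1 → ∃ (Join P x y)
  unique∨⇒join P {x} {y} ∣∨∣≡1 with j , j∈⋁ , unique ← ∣p∣≡1⇒unique ∣∨∣≡1
    with j∈ , x≤j , y≤j ← bound-pair P (proj₁ (∈-⋁⁻ P j∈⋁)) =
    j , record { j∈ = j∈ ; left = x≤j ; right = y≤j ; least = least }
    where
    least : ∀ {v} → v ∈ support P → x ≤ v → y ≤ v → j ≤ v
    least v∈ x≤v y≤v
      with m , bound , m≤v , min ← minimal (upperBound? P (⁅ x ⁆ ∪ ⁅ y ⁆)) (pair-bound P v∈ x≤v y≤v)
      with refl ← unique (∈-⋁⁺ P (bound , λ w → min)) = m≤v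

  -- Projection onto a TM-ideal.

  -- `greatest` makes the projection monotone. `covers` leaves no room strictly between `p` and `x`,
  -- so joining `p` with an atom below `x` that is not below `p` gives back `x`.
  record Projection (P Q : FinitePoset O) (x p : Fin n) : Set where
    field
      p∈       : p ∈ support Q
      covers   : Covers P x p
      greatest : ∀ {q} → q ∈ support Q → q ≤ x → q ≤ p

  -- The consequences of Q being a TM-ideal of P with rank P = rank Q + 1
  -- that survive in the deletions of P at atoms outside Q.
  record Fibration (P Q : FinitePoset O) : Set where
    field
      axioms     : LocalAxioms P
      subset     : support Q ⊆ support P
      downClosed : ∀ {x y} → x ∈ support P → y ∈ support Q → x ≤ y → x ∈ support Q
      project    : ∀ {x} → x ∈ support P → x ∉ support Q → ∃ (Projection P Q x)
      join       : ∀ {a y} → IsAtom P a → a ∉ support Q → y ∈ support Q → ∃ (Join P a y)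

  module _ (P Q : FinitePoset O) (tm : IsTMIdeal P Q) (rank-suc : rank P ≡ suc (rank Q)) where
    open IsTMIdeal tm
    open IsMIdeal isMIdeal
    open LocalAxioms (locallyGeometric⇒axioms P locallyGeometric)

    private
      down : ∀ {x y} → x ∈ support P → y ∈ support Q → x ≤ y → x ∈ support Q
      down = downClosed _ _

    -- Purity gives all maximal elements of `Q` the same rank, and an element of largest rank lies
    -- below one of them.
    rk-maximal : ∀ {y} → Maximal Q y → rk P y ≡ rank Q
    rk-maximal {y} y-max@(y∈ , _) with x , x∈ , eq ← rank-attained Q
      with m , m-max , x≤m ← maximalAbove Q x∈ = trans (sym (rk-ideal P Q subset down y∈))
      (ℕ.≤-antisym (rank-upper Q y∈) (begin
        rank Q ≡⟨ eq ⟩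
        rk Q x ≤⟨ rk-mono-≤ Q x∈ x≤m ⟩
        rk Q m ≡⟨ pure m y m-max y-max ⟩
        rk Q y ∎))
      where open ℕ.≤-Reasoning

    -- The witness is `y ∧ x` for a modular maximal `y` of `Q` below a maximal `m` above `x`. If `q`
    -- in `Q` is below `x`, its join with `y` below `m` stays in `Q` and so equals `y`; hence `q` is
    -- below `y ∧ x`. The cover comes from ranks: `rk x` exceeds `rk (y ∧ x)` by at most one.
    tmIdeal⇒project : ∀ {x} → x ∈ support P → x ∉ support Q → ∃ (Projection P Q x)
    tmIdeal⇒project {x} x∈ x∉ with m , m-max@(m∈ , _) , x≤m ← maximalAbove P x∈
      with y , y-max@(y∈Q , y-top) , y-modular ← modular (m , m∈) m-max =
      p , record { p∈ = p∈Q
                 ; covers = p∈ , x∈ , p<x , λ w w∈ (p<w , w<x) → ℕ.<-irrefl refl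
                     (ℕ.<-≤-trans (ℕ.<-≤-trans (s≤s (rk-mono P p∈ p<w)) (rk-mono P w∈ w<x)) rk-x≤)
                 ; greatest = greatest }
      where
      open GeometricLattice (LocallyGeometric.local locallyGeometric (m , m∈))
      open IsLattice isLattice using (x≤x∨y; y≤x∨y; ∨-least; x∧y≤x; x∧y≤y; ∧-greatest)
      elem : ∀ {z} → z ∈ support P → z ≤ m → Element (_↓_ P (m , m∈))
      elem z∈ z≤m = _ , ∈-↓⁺ P (m , m∈) z∈ z≤m
      y∈ : proj₁ y ∈ support P
      y∈ = subset y∈Q
      y≤m : proj₁ y ≤ m
      y≤m = proj₂ (∈-↓⁻ P (m , m∈) (proj₂ y))
      x′ p′ : Element (_↓_ P (m , m∈))
      x′ = elem x∈ x≤m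
      p′ = y ∧ x′
      p : Fin n
      p = proj₁ p′
      p∈ : p ∈ support P
      p∈ = proj₁ (∈-↓⁻ P (m , m∈) (proj₂ p′))
      p∈Q : p ∈ support Q
      p∈Q = down p∈ y∈Q (x∧y≤x y x′)
      p<x : p < x
      p<x = x∧y≤y y x′ , λ p≡x → x∉ (subst (_∈ support Q) p≡x p∈Q)
      greatest : ∀ {q} → q ∈ support Q → q ≤ x → q ≤ p
      greatest {q} q∈ q≤x with j , J ← join m∈ (subset q∈) y∈ (≤-trans q≤x x≤m) y≤m =
        ∧-greatest {elem (subset q∈) (≤-trans q≤x x≤m)} {y} {x′} q≤y q≤x
        where
        open JoinBelow J
        T⊆Q : ⁅ q ⁆ ∪ ⁅ proj₁ y ⁆ ⊆ support Q
        T⊆Q t∈ with ∈∪⁅⁆⁻ t∈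
        ... | inj₁ t∈q with refl ← x∈⁅y⁆⇒x≡y q t∈q = q∈
        ... | inj₂ refl = y∈Q
        q≤y : q ≤ proj₁ y
        q≤y = subst (q ≤_) (y-top j (joinClosed _ T⊆Q (joinBelow⇒∈⋁ P J)) right) left
      -- Modularity of y makes z ↦ x ∨ z strictly increasing on [x ∧ y , y].
      rk-sum : ∀ {z} (z∈ : z ∈ support P) → Acc _<_ z → p ≤ z → (z≤y : z ≤ proj₁ y) →
               rk P z ℕ.+ rk P x ℕ.≤ rk P (proj₁ (x′ ∨ elem z∈ (≤-trans z≤y y≤m))) ℕ.+ rk P p
      rk-sum {z} z∈ (acc rs) p≤z z≤y with z ≟ p
      ... | yes refl = ℕ.≤-trans (ℕ.≤-reflexive (ℕ.+-comm (rk P p) (rk P x)))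
                         (ℕ.+-monoˡ-≤ (rk P p) (rk-mono-≤ P x∈ (x≤x∨y x′ (elem z∈ (≤-trans z≤y y≤m)))))
      ... | no z≢p with w , p≤w , cov@(w∈ , _ , w<z , _) ← coverBelow P p∈ z∈ (p≤z , z≢p ∘ sym) = begin
        rk P z ℕ.+ rk P x                       ≡⟨ cong (ℕ._+ rk P x) (graded cov) ⟩
        suc (rk P w ℕ.+ rk P x)                 ≤⟨ s≤s (rk-sum w∈ (rs w<z) p≤w w≤y) ⟩
        suc (rk P (proj₁ (x′ ∨ w′)) ℕ.+ rk P p) ≤⟨ ℕ.+-monoˡ-≤ (rk P p)
                                                    (rk-mono P (proj₁ (∈-↓⁻ P (m , m∈) (proj₂ (x′ ∨ w′)))) ∨<∨) ⟩
        rk P (proj₁ (x′ ∨ z′)) ℕ.+ rk P p       ∎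
        where
        open ℕ.≤-Reasoning
        w≤y : w ≤ proj₁ y
        w≤y = ≤-trans (<⇒≤ w<z) z≤y
        w′ z′ : Element (_↓_ P (m , m∈))
        w′ = elem w∈ (≤-trans w≤y y≤m)
        z′ = elem z∈ (≤-trans z≤y y≤m)
        ∨<∨ : proj₁ (x′ ∨ w′) < proj₁ (x′ ∨ z′)
        ∨<∨ = ∨-least {x′} {w′} {x′ ∨ z′} (x≤x∨y x′ z′) (≤-trans (<⇒≤ w<z) (y≤x∨y x′ z′)) ,
          -- If the joins agreed, then z ≤ y ∧ (x ∨ w) = (y ∧ x) ∨ w = w by modularity, against
          -- `w < z`.
          λ eq → <⇒≱ w<z (≤-trans
            (∧-greatest {z′} {y} {x′ ∨ w′} z≤y (subst (z ≤_) (sym eq) (y≤x∨y x′ z′)))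
            (≤-trans (≤-reflexive (y-modular x′ w′ w≤y)) (∨-least {p′} {w′} {w′} p≤w ≤-refl)))
      -- Here the rank difference of one enters: `x ∨ y` has rank at most `rk y + 1`, and `rk y`
      -- cancels.
      rk-x≤ : rk P x ℕ.≤ suc (rk P p)
      rk-x≤ = ℕ.+-cancelˡ-≤ (rk P (proj₁ y)) _ _ (begin
        rk P (proj₁ y) ℕ.+ rk P x               ≤⟨ rk-sum y∈ (<-wf {O = O} (proj₁ y)) (x∧y≤x y x′) ≤-refl ⟩
        rk P (proj₁ j) ℕ.+ rk P p               ≤⟨ ℕ.+-monoˡ-≤ (rk P p)
                                                    (rank-upper P (proj₁ (∈-↓⁻ P (m , m∈) (proj₂ j)))) ⟩
        rank P ℕ.+ rk P p                       ≡⟨ cong (ℕ._+ rk P p)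
                                                    (trans rank-suc (cong suc (sym (rk-maximal y-max)))) ⟩
        suc (rk P (proj₁ y) ℕ.+ rk P p)         ≡⟨ ℕ.+-suc _ _ ⟨
        rk P (proj₁ y) ℕ.+ suc (rk P p)         ∎)
        where
        open ℕ.≤-Reasoning
        -- The bound is written as a composite so that this join is literally the one in the type of
        -- `rk-sum`.
        j = x′ ∨ elem y∈ (≤-trans ≤-refl y≤m)

    tmIdeal⇒fibration : Fibration P Q
    tmIdeal⇒fibration = record
      { axioms     = locallyGeometric⇒axioms P locallyGeometric
      ; subset     = subset
      ; downClosed = down
      ; project    = tmIdeal⇒project
      ; join       = λ atom a∉ y∈ → unique∨⇒join P (uniqueJoins _ _ atom (a∉ ∘ proj₁) y∈)
      }

  -- Subposets generated by atoms.

  module _ (P : FinitePoset O) (B : Subset n) where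

    -- If `x` is a minimal upper bound of some subset of `B`, it is one of the largest candidate,
    -- all of `B` below `x`. Testing that set replaces the search over subsets, and the empty case
    -- yields exactly `0̂`.
    Generated : Fin n → Set
    Generated x = ∀ {v} → v ∈ support P → v ≤ x →
                  (∀ {b} → b ∈ B → b ≤ x → b ≤ v) → v ≡ x

    ∈-⟨⟩⁺ : ∀ {x} → x ∈ support P → Generated x → x ∈ support (⟨_⟩ P B)
    ∈-⟨⟩⁺ {x} x∈ gen = ∈⟪⟫⁺ (generatedBy? P B) generated
      where
      T? : Decidable (λ b → b ∈ B × b ≤ x)
      T? b = b ∈? B ×-dec b ≤? x
      generated : GeneratedBy P B x
      generated with nonempty? ⟪ T? ⟫
      ... | no empty = inj₁ (sym (gen (0̂∈ P) (0̂-least P x∈)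
              λ b∈ b≤x → contradiction (_ , ∈⟪⟫⁺ T? (b∈ , b≤x)) empty))
      ... | yes nonempty = inj₂ (⟪ T? ⟫ , nonempty , proj₁ ∘ ∈⟪⟫⁻ T? ,
              ∈-⋁⁺ P ((x∈ , λ t t∈ → proj₂ (∈⟪⟫⁻ T? t∈)) ,
                λ v (v∈ , bound) v≤x → gen v∈ v≤x λ b∈ b≤x → bound _ (∈⟪⟫⁺ T? (b∈ , b≤x))))

    ∈-⟨⟩⁻ : ∀ {x} → x ∈ support (⟨_⟩ P B) → x ∈ support P × Generated x
    ∈-⟨⟩⁻ x∈ with ∈⟪⟫⁻ (generatedBy? P B) x∈
    ... | inj₁ refl = 0̂∈ P , λ v∈ v≤0 _ → ≤0̂⇒≡0̂ P v∈ v≤0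
    ... | inj₂ (T , _ , T⊆B , x∈⋁) with (x∈P , bound) , min ← ∈-⋁⁻ P x∈⋁ =
      x∈P , λ {v} v∈ v≤x above → min v (v∈ , λ t t∈ → above (T⊆B t∈) (bound t t∈)) v≤x

  -- D stands for ⟨ B ⟩, known only through its elements so that the decision
  -- procedures in its support are never unfolded.
  record IsGenerated (P D : FinitePoset O) (B : Subset n) : Set where
    field
      0̂≡ : 0̂ D ≡ 0̂ P
      ∈⁺ : ∀ {x} → x ∈ support P → Generated P B x → x ∈ support D
      ∈⁻ : ∀ {x} → x ∈ support D → x ∈ support P × Generated P B x

  ⟨⟩-isGenerated : ∀ P B → IsGenerated P (⟨_⟩ P B) B
  ⟨⟩-isGenerated P B = record { 0̂≡ = refl ; ∈⁺ = ∈-⟨⟩⁺ P B ; ∈⁻ = ∈-⟨⟩⁻ P B }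

  module Subposet (P D : FinitePoset O) (ax : LocalAxioms P)
                  (B : Subset n) (B-atoms : ∀ {b} → b ∈ B → IsAtom P b)
                  (isGenerated : IsGenerated P D B) where
    open LocalAxioms ax
    open IsGenerated isGenerated

    ⊆P : ∀ {x} → x ∈ support D → x ∈ support P
    ⊆P = proj₁ ∘ ∈⁻

    B⊆ : ∀ {b} → b ∈ B → b ∈ support D
    B⊆ b∈ = ∈⁺ (proj₁ (B-atoms b∈)) λ v∈ v≤b above → antisym v≤b (above b∈ ≤-refl)

    -- If `v ≤ j` lies above all of `B` below `j`, then the meet of `x` and `v` lies above all of
    -- `B` below `x`. As `x` is generated, that meet is `x`, so `x ≤ v`; likewise `y ≤ v`, and
    -- therefore `j ≤ v`.
    join-∈ : ∀ {x y j} → x ∈ support D → y ∈ support D → JoinBelow P j x y j → j ∈ support D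
    join-∈ {x} {y} {j} x∈ y∈ J = ∈⁺ j∈ λ v∈ v≤j above →
      antisym v≤j (least v∈ (below left x∈ v∈ v≤j above) (below right y∈ v∈ v≤j above) v≤j)
      where
      open JoinBelow J
      below : ∀ {z v} → z ≤ j → z ∈ support D → v ∈ support P → v ≤ j →
              (∀ {b} → b ∈ B → b ≤ j → b ≤ v) → z ≤ v
      below {z} {v} z≤j z∈ v∈ v≤j above
        with z∈P , gen ← ∈⁻ z∈
        with w , M ← meet j∈ z∈P v∈ z≤j v≤j =
        subst (_≤ v) (gen (Meet.w∈ M) (Meet.left M) λ b∈ b≤z →
          Meet.greatest M (proj₁ (B-atoms b∈)) b≤z (above b∈ (≤-trans b≤z z≤j))) (Meet.right M)

    atomBelow-⟨⟩ : ∀ {x y} → x ∈ support P → y ∈ support D → x < y →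
                   ∃ λ b → b ∈ B × b ≤ y × ¬ (b ≤ x)
    atomBelow-⟨⟩ {x} {y} x∈ y∈ (x≤y , x≢y) with any? (λ b → b ∈? B ×-dec b ≤? y ×-dec ¬? (b ≤? x))
    ... | yes found = found
    ... | no none   = contradiction (proj₂ (∈⁻ y∈) x∈ x≤y below) x≢y
      where
      below : ∀ {b} → b ∈ B → b ≤ y → b ≤ x
      below {b} b∈ b≤y with b ≤? x
      ... | yes b≤x = b≤x
      ... | no b≰x  = contradiction (b , b∈ , b≤y , b≰x) none

    -- Some `b` in `B` is below `y` but not below `x`. The join of `x` and `b` below `y` covers `x`
    -- in `P` and lies in `D`, so it must be `y`.
    covers-⟨⟩ : ∀ {x y} → Covers D y x → Covers P y x
    covers-⟨⟩ {x} {y} (x∈ , y∈ , x<y@(x≤y , _) , none)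
      with b , b∈ , b≤y , b≰x ← atomBelow-⟨⟩ (⊆P x∈) y∈ x<y
      with j , J ← join (⊆P y∈) (⊆P x∈) (proj₁ (B-atoms b∈)) x≤y b≤y
      with cov@(_ , _ , x<j , _) ← joinCovers (⊆P x∈) (B-atoms b∈) b≰x (shrink J)
      with j ≟ y
    ... | yes refl = cov
    ... | no j≢y   = contradiction (x<j , JoinBelow.j≤t J , j≢y)
                       (none j (join-∈ x∈ (B⊆ b∈) (shrink J)))

    rk-⟨⟩ : ∀ {x} → x ∈ support D → rk D x ≡ rk P x
    rk-⟨⟩ = rk-agree P D ⊆P descend 0̂≡
      where
      descend : ∀ {y} → y ∈ support D → y ≢ 0̂ D →
        ∃ λ x → x ∈ support D × x < y × rk P y ≡ suc (rk P x)
      descend y∈ y≢0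
        with x , _ , cov@(x∈ , _ , x<y , _) ← coverBelow D (0̂∈ D) y∈ (≢0̂⇒0̂< D y∈ y≢0) =
        x , x∈ , x<y , graded (covers-⟨⟩ cov)

    atom-⟨⟩⁺ : ∀ {b} → b ∈ B → IsAtom D b
    atom-⟨⟩⁺ b∈ = B⊆ b∈ , trans (rk-⟨⟩ (B⊆ b∈)) (proj₂ (B-atoms b∈))

    atom-⟨⟩⁻ : ∀ {a} → IsAtom D a → IsAtom P a
    atom-⟨⟩⁻ (a∈ , rk≡1) = ⊆P a∈ , trans (sym (rk-⟨⟩ a∈)) rk≡1

    -- No element of `B` lies below such an atom, so being generated would collapse it to `0̂`.
    -- Hence a deletion really loses an element, on which the later induction rests.
    atom∉B⇒∉ : ∀ {a} → IsAtom P a → a ∉ B → a ∉ support D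
    atom∉B⇒∉ {a} atom a∉B a∈ = atom⇒≢0̂ P atom
      (sym (proj₂ (∈⁻ a∈) (0̂∈ P) (0̂-least P (proj₁ atom)) below))
      where
      below : ∀ {b} → b ∈ B → b ≤ a → b ≤ 0̂ P
      below b∈ b≤a with below-atom P atom (proj₁ (B-atoms b∈)) b≤a
      ... | inj₁ refl = ≤-refl
      ... | inj₂ refl = contradiction b∈ a∉B

    join-⟨⟩ : ∀ {t x y} → t ∈ support D → x ∈ support D → y ∈ support D →
              x ≤ t → y ≤ t → ∃ λ j → JoinBelow P t x y j × JoinBelow D t x y j
    join-⟨⟩ t∈ x∈ y∈ x≤t y≤t with j , J ← join (⊆P t∈) (⊆P x∈) (⊆P y∈) x≤t y≤t =
      j , J , record { j∈ = join-∈ x∈ y∈ (shrink J) ; left = left ; right = right ; j≤t = j≤t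
                     ; least = λ v∈ → least (⊆P v∈) }
      where open JoinBelow J

    axioms-⟨⟩ : LocalAxioms D
    axioms-⟨⟩ = record
      { graded     = λ cov@(x∈ , y∈ , _) →
          trans (rk-⟨⟩ y∈) (trans (graded (covers-⟨⟩ cov)) (cong suc (sym (rk-⟨⟩ x∈))))
      ; join       = λ t∈ x∈ y∈ x≤t y≤t →
          let j , _ , J = join-⟨⟩ t∈ x∈ y∈ x≤t y≤t in j , J
      ; atomBelow  = λ cov@(x∈ , y∈ , x<y , _) →
          let b , b∈ , b≤y , b≰x = atomBelow-⟨⟩ (⊆P x∈) y∈ x<y
          in b , atom-⟨⟩⁺ b∈ , b≤y , b≰x
      ; joinCovers = joinCovers′
      }
      where
      joinCovers′ : ∀ {x a j} → x ∈ support D → IsAtom D a → ¬ (a ≤ x) →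
                    JoinBelow D j x a j → Covers D j x
      joinCovers′ x∈ atom a≰x J
        -- `j` is known as a join in `D` only. The join taken in `P` also lies in `D`, so leastness
        -- identifies the two.
        with i , I , I′ ← join-⟨⟩ (JoinBelow.j∈ J) x∈ (proj₁ atom) (JoinBelow.left J) (JoinBelow.right J)
        with refl ← antisym (JoinBelow.j≤t I)
                      (JoinBelow.least J (JoinBelow.j∈ I′)
                        (JoinBelow.left I) (JoinBelow.right I) (JoinBelow.j≤t I))
        with _ , _ , x<j , none ← joinCovers (⊆P x∈) (atom-⟨⟩⁻ atom) a≰x I =
        x∈ , JoinBelow.j∈ J , x<j , λ z z∈ → none z (⊆P z∈)

    record Top (x t : Fin n) : Set where
      field
        t∈       : t ∈ support D
        t≤       : t ≤ x
        greatest : ∀ {z} → z ∈ support D → z ≤ x → z ≤ t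

    -- A maximal element of `D` below `x` is greatest because joins below `x` stay in `D`. This
    -- turns sums over the part of `D` below `x` into sums over a lower interval of `D`.
    top-⟨⟩ : ∀ {x} → x ∈ support P → ∃ (Top x)
    top-⟨⟩ {x} x∈ with t , (t∈ , t≤x) , _ , max ←
      maximal (λ z → z ∈? support D ×-dec z ≤? x) (0̂∈ D , subst (_≤ x) (sym 0̂≡) (0̂-least P x∈)) =
      t , record { t∈ = t∈ ; t≤ = t≤x ; greatest = greatest }
      where
      greatest : ∀ {z} → z ∈ support D → z ≤ x → z ≤ t
      greatest {z} z∈ z≤x with j , J ← join x∈ (⊆P z∈) (⊆P t∈) z≤x t≤x =
        subst (z ≤_) (max (join-∈ z∈ t∈ (shrink J) , j≤t) right) left
        where open JoinBelow J

  -- Möbius function and coefficients of the characteristic polynomial.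

  module _ (P : FinitePoset O) where

    μ₀ : Fin n → ℤ
    μ₀ = μ P (0̂ P)

    δ : Fin n → ℤ
    δ x = given (x ≟ 0̂ P) (λ _ → 1ℤ) 0ℤ

    -- The shape of the predicate is taken from `μ-unfold`, whose sum is then a `∑` over it by
    -- definition.
    strictlyBelow? : ∀ x → Decidable (λ z → z ∈ support P × 0̂ P ≤ z × z < x)
    strictlyBelow? x z = z ∈? support P ×-dec 0̂ P ≤? z ×-dec z ≺? x

    ∑-below : ∀ f {x} → x ∈ support P → ∑ (below? P x) f ≡ f x ℤ.+ ∑ (strictlyBelow? x) f
    ∑-below f {x} x∈ = ∑-insert (below? P x) (strictlyBelow? x) f (x∈ , ≤-refl)
      (λ (_ , _ , _ , x≢x) → x≢x refl) (λ (z∈ , _ , z<x) → z∈ , <⇒≤ z<x)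
      (λ (z∈ , z≤x) z≢x → z∈ , 0̂-least P z∈ , z≤x , z≢x)

    μ-sum : ∀ {x} → x ∈ support P → ∑ (below? P x) μ₀ ≡ δ x
    μ-sum {x} x∈ with x ≟ 0̂ P
    ... | yes refl = trans (∑-below μ₀ x∈) (trans
      (cong₂ ℤ._+_ (trans (μ-unfold P x x) (given-yes (x ≟ x) refl))
        (∑-empty (strictlyBelow? x) λ (z∈ , 0≤z , z<x) → <⇒≱ z<x 0≤z))
      (ℤ.+-identityʳ 1ℤ))
    ... | no x≢0   = trans (∑-below μ₀ x∈) (trans
      (cong (λ v → v ℤ.+ ∑ (strictlyBelow? x) μ₀)
        (trans (μ-unfold P (0̂ P) x) (given-no (0̂ P ≟ x) (x≢0 ∘ sym))))
      (ℤ.+-inverseˡ (∑ (strictlyBelow? x) μ₀)))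

    -- The sums over lower intervals determine a function recursively from below. Each identity
    -- between Möbius functions is thereby reduced to one between such sums.
    μ-unique : ∀ f → (∀ {x} → x ∈ support P → ∑ (below? P x) f ≡ δ x) →
               ∀ {x} → x ∈ support P → f x ≡ μ₀ x
    μ-unique f f-sum {x} x∈ = go x x∈ (<-wf {O = O} x)
      where
      go : ∀ x → x ∈ support P → Acc _<_ x → f x ≡ μ₀ x
      go x x∈ (acc rs) = ℤ-Group.∙-cancelʳ (∑ (strictlyBelow? x) μ₀) (f x) (μ₀ x) (begin
        f x ℤ.+ ∑ (strictlyBelow? x) μ₀ ≡⟨ cong (λ v → f x ℤ.+ v) (∑-cong (strictlyBelow? x) (strictlyBelow? x)
                                          (λ p → p) (λ p → p) λ (z∈ , _ , z<x) → go _ z∈ (rs z<x)) ⟨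
        f x ℤ.+ ∑ (strictlyBelow? x) f ≡⟨ ∑-below f x∈ ⟨
        ∑ (below? P x) f               ≡⟨ f-sum x∈ ⟩
        δ x                            ≡⟨ μ-sum x∈ ⟨
        ∑ (below? P x) μ₀               ≡⟨ ∑-below μ₀ x∈ ⟩
        μ₀ x ℤ.+ ∑ (strictlyBelow? x) μ₀ ∎)
        where open ≡-Reasoning

    corank? : ∀ s k → Decidable (λ x → x ∈ support P × s ∸ rk P x ≡ k)
    corank? s k x = x ∈? support P ×-dec (s ∸ rk P x) ℕ.≟ k

    -- X (rank P) k is the k-th coefficient of χ P.
    X : ℕ → ℕ → ℤ
    X s k = ∑ (corank? s k) μ₀

  -- Invariance under isomorphism.

  record Iso (P P₂ : FinitePoset O) : Set where
    field
      to from   : Fin n → Fin n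
      to∈       : ∀ {x} → x ∈ support P → to x ∈ support P₂
      from∈     : ∀ {y} → y ∈ support P₂ → from y ∈ support P
      to-mono   : ∀ {x x′} → x ∈ support P → x′ ∈ support P → x ≤ x′ → to x ≤ to x′
      from-mono : ∀ {y y′} → y ∈ support P₂ → y′ ∈ support P₂ → y ≤ y′ → from y ≤ from y′
      from-to   : ∀ {x} → x ∈ support P → from (to x) ≡ x
      to-from   : ∀ {y} → y ∈ support P₂ → to (from y) ≡ y

    to≤ : ∀ {x y} → x ∈ support P → y ∈ support P₂ → x ≤ from y → to x ≤ y
    to≤ x∈ y∈ x≤ = subst (to _ ≤_) (to-from y∈) (to-mono x∈ (from∈ y∈) x≤)

    ≤to : ∀ {x y} → x ∈ support P → y ∈ support P₂ → from y ≤ x → y ≤ to x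
    ≤to x∈ y∈ ≤x = subst (_≤ to _) (to-from y∈) (to-mono (from∈ y∈) x∈ ≤x)

    from≤ : ∀ {x y} → x ∈ support P → y ∈ support P₂ → y ≤ to x → from y ≤ x
    from≤ x∈ y∈ y≤ = subst (from _ ≤_) (from-to x∈) (from-mono y∈ (to∈ x∈) y≤)

    ≤from : ∀ {x y} → x ∈ support P → y ∈ support P₂ → to x ≤ y → x ≤ from y
    ≤from x∈ y∈ ≤y = subst (_≤ from _) (from-to x∈) (from-mono (to∈ x∈) y∈ ≤y)

    to-injective : ∀ {x x′} → x ∈ support P → x′ ∈ support P → to x ≡ to x′ → x ≡ x′
    to-injective x∈ x′∈ eq = trans (sym (from-to x∈)) (trans (cong from eq) (from-to x′∈))

    to-mono-< : ∀ {x x′} → x ∈ support P → x′ ∈ support P → x < x′ → to x < to x′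
    to-mono-< x∈ x′∈ (x≤x′ , x≢x′) = to-mono x∈ x′∈ x≤x′ , x≢x′ ∘ to-injective x∈ x′∈

    to-0̂ : to (0̂ P) ≡ 0̂ P₂
    to-0̂ = ≤0̂⇒≡0̂ P₂ (to∈ (0̂∈ P)) (to≤ (0̂∈ P) (0̂∈ P₂) (0̂-least P (from∈ (0̂∈ P₂))))

  Iso-sym : ∀ {P P₂} → Iso P P₂ → Iso P₂ P
  Iso-sym i = record
    { to = from ; from = to ; to∈ = from∈ ; from∈ = to∈ ; to-mono = from-mono
    ; from-mono = to-mono ; from-to = to-from ; to-from = from-to }
    where open Iso i

  ⊆⊇⇒Iso : ∀ {P P₂ : FinitePoset O} → support P ⊆ support P₂ → support P₂ ⊆ support P → Iso P P₂
  ⊆⊇⇒Iso P⊆ P⊇ = record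
    { to = λ x → x ; from = λ x → x ; to∈ = P⊆ ; from∈ = P⊇ ; to-mono = λ _ _ x≤ → x≤
    ; from-mono = λ _ _ x≤ → x≤ ; from-to = λ _ → refl ; to-from = λ _ → refl }

  restrict : ∀ {P P₂ D D₂ : FinitePoset O} (i : Iso P P₂) →
             support D ⊆ support P → support D₂ ⊆ support P₂ →
             (∀ {x} → x ∈ support D → Iso.to i x ∈ support D₂) →
             (∀ {y} → y ∈ support D₂ → Iso.from i y ∈ support D) → Iso D D₂
  restrict i D⊆ D₂⊆ D→D₂ D₂→D = record
    { to = to ; from = from ; to∈ = D→D₂ ; from∈ = D₂→D
    ; to-mono = λ x∈ x′∈ → to-mono (D⊆ x∈) (D⊆ x′∈)
    ; from-mono = λ y∈ y′∈ → from-mono (D₂⊆ y∈) (D₂⊆ y′∈)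
    ; from-to = from-to ∘ D⊆ ; to-from = to-from ∘ D₂⊆ }
    where open Iso i

  module _ {P P₂ : FinitePoset O} (i : Iso P P₂) where
    open Iso i

    rk-iso : ∀ {x} → x ∈ support P → rk P x ≡ rk P₂ (to x)
    rk-iso = rk-unique P (rk P₂ ∘ to)
        (λ x∈ y∈ x<y → rk-mono P₂ (to∈ x∈) (to-mono-< x∈ y∈ x<y)) attained
      where
      attained : ∀ {y} → y ∈ support P → rk P₂ (to y) ≡ 0 ⊎
        (∃ λ x → x ∈ support P × x < y × rk P₂ (to y) ≡ suc (rk P₂ (to x)))
      attained {y} y∈ with rk-attained P₂ (to y)
      ... | inj₁ eq = inj₁ eq
      ... | inj₂ (z , z∈ , (z≤ , z≢) , eq) = inj₂
        (from z , from∈ z∈ , (from≤ y∈ z∈ z≤ , λ { refl → z≢ (sym (to-from z∈)) }) ,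
         trans eq (cong (suc ∘ rk P₂) (sym (to-from z∈))))

    rank-≤ : rank P ℕ.≤ rank P₂
    rank-≤ with x , x∈ , eq ← rank-attained P = subst (ℕ._≤ rank P₂)
      (sym (trans eq (rk-iso x∈))) (rank-upper P₂ (to∈ x∈))

    atom-iso : ∀ {a} → IsAtom P a → IsAtom P₂ (to a)
    atom-iso (a∈ , rk≡1) = to∈ a∈ , trans (sym (rk-iso a∈)) rk≡1

    covers-iso : ∀ {x y} → Covers P y x → Covers P₂ (to y) (to x)
    covers-iso (x∈ , y∈ , x<y , none) = to∈ x∈ , to∈ y∈ , to-mono-< x∈ y∈ x<y ,
      λ z z∈ ((≤z , ≢z) , (z≤ , z≢)) → none (from z) (from∈ z∈)
        ((≤from x∈ z∈ ≤z , λ { refl → ≢z (to-from z∈) }) ,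
         (from≤ y∈ z∈ z≤ , λ { refl → z≢ (sym (to-from z∈)) }))

    join-iso : ∀ {t x y j} → t ∈ support P₂ → x ∈ support P₂ → y ∈ support P₂ →
               JoinBelow P (from t) (from x) (from y) j → JoinBelow P₂ t x y (to j)
    join-iso t∈ x∈ y∈ J = record
      { j∈ = to∈ j∈ ; left = ≤to j∈ x∈ left ; right = ≤to j∈ y∈ right ; j≤t = to≤ j∈ t∈ j≤t
      ; least = λ v∈ x≤v y≤v v≤t → to≤ j∈ v∈
          (least (from∈ v∈) (from-mono x∈ v∈ x≤v) (from-mono y∈ v∈ y≤v) (from-mono v∈ t∈ v≤t)) }
      where open JoinBelow J

    μ₀-iso : ∀ {x} → x ∈ support P → μ₀ P₂ (to x) ≡ μ₀ P x
    μ₀-iso = μ-unique P (μ₀ P₂ ∘ to) λ {x} x∈ → begin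
      ∑ (below? P x) (μ₀ P₂ ∘ to) ≡⟨ ∑-reindex (below? P x) (below? P₂ (to x)) (μ₀ P₂) to from
                                     (λ (z∈ , z≤x) → to∈ z∈ , to-mono z∈ x∈ z≤x)
                                     (λ (z∈ , z≤) → from∈ z∈ , from≤ x∈ z∈ z≤)
                                     (from-to ∘ proj₁) (to-from ∘ proj₁) ⟩
      ∑ (below? P₂ (to x)) (μ₀ P₂) ≡⟨ μ-sum P₂ (to∈ x∈) ⟩
      δ P₂ (to x)                 ≡⟨ given-cong₂ (to x ≟ 0̂ P₂) (x ≟ 0̂ P)
                                      (λ eq → to-injective x∈ (0̂∈ P) (trans eq (sym to-0̂)))
                                      (λ { refl → to-0̂ }) (λ _ → refl) ⟩
      δ P x                       ∎
      where open ≡-Reasoning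

    X-iso : ∀ s k → X P s k ≡ X P₂ s k
    X-iso s k = begin
      ∑ (corank? P s k) (μ₀ P)         ≡⟨ ∑-cong (corank? P s k) (corank? P s k) (λ p → p) (λ p → p)
                                          (λ (x∈ , _) → μ₀-iso x∈) ⟨
      ∑ (corank? P s k) (μ₀ P₂ ∘ to)   ≡⟨ ∑-reindex (corank? P s k) (corank? P₂ s k) (μ₀ P₂) to from
                                          (λ (x∈ , eq) → to∈ x∈ , trans (cong (s ∸_) (sym (rk-iso x∈))) eq)
                                          (λ (y∈ , eq) → from∈ y∈ , trans (cong (s ∸_)
                                            (trans (rk-iso (from∈ y∈)) (cong (rk P₂) (to-from y∈)))) eq)
                                          (from-to ∘ proj₁) (to-from ∘ proj₁) ⟩
      ∑ (corank? P₂ s k) (μ₀ P₂)       ∎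
      where open ≡-Reasoning

    generated-iso : ∀ {B B₂} → (∀ {b} → b ∈ B → b ∈ support P) → (∀ {b} → b ∈ B → to b ∈ B₂) →
                    ∀ {x} → x ∈ support P → Generated P B x → Generated P₂ B₂ (to x)
    generated-iso B⊆ B→B₂ x∈ gen {v} v∈ v≤ above = trans (sym (to-from v∈)) (cong to
      (gen (from∈ v∈) (from≤ x∈ v∈ v≤) λ b∈ b≤x →
        ≤from (B⊆ b∈) v∈ (above (B→B₂ b∈) (to-mono (B⊆ b∈) x∈ b≤x))))

  ∈-atoms-⁺ : ∀ (P : FinitePoset O) {a b} → IsAtom P b → b ≢ a → b ∈ atoms P - a
  ∈-atoms-⁺ P atom b≢a = x∈p∧x≢y⇒x∈p-y (∈⟪⟫⁺ (atom? P) atom) b≢a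

  ∈-atoms-⁻ : ∀ (P : FinitePoset O) {a b} → b ∈ atoms P - a → IsAtom P b × b ≢ a
  ∈-atoms-⁻ P b∈ = ∈⟪⟫⁻ (atom? P) (∈-⇒∈ b∈) , ∈-⇒≢ b∈

  module _ {P P₂ : FinitePoset O} (i : Iso P P₂) where
    open Iso i

    χ-iso : ∀ k → coeff (χ P) k ≡ coeff (χ P₂) k
    χ-iso k = trans (X-iso i (rank P) k)
      (cong (λ r → X P₂ r k) (ℕ.≤-antisym (rank-≤ i) (rank-≤ (Iso-sym i))))

    axioms-iso : LocalAxioms P → LocalAxioms P₂
    axioms-iso ax = record
      { graded = λ cov@(x∈ , y∈ , _) → begin
          rk P₂ _             ≡⟨ rk-iso (Iso-sym i) y∈ ⟩
          rk P (from _)       ≡⟨ graded (covers-iso (Iso-sym i) cov) ⟩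
          suc (rk P (from _)) ≡⟨ cong suc (rk-iso (Iso-sym i) x∈) ⟨
          suc (rk P₂ _)       ∎
      ; join = λ t∈ x∈ y∈ x≤t y≤t →
          let j , J = join (from∈ t∈) (from∈ x∈) (from∈ y∈)
                        (from-mono x∈ t∈ x≤t) (from-mono y∈ t∈ y≤t)
          in to j , join-iso i t∈ x∈ y∈ J
      ; atomBelow = λ cov@(x∈ , y∈ , _) →
          let a , atom , a≤y , a≰x = atomBelow (covers-iso (Iso-sym i) cov)
          in to a , atom-iso i atom , to≤ (proj₁ atom) y∈ a≤y , λ a≤x → a≰x (≤from (proj₁ atom) x∈ a≤x)
      ; joinCovers = λ {x} {a} {j} x∈ atom a≰x J →
          subst (λ y → Covers P₂ _ y) (to-from x∈)
            (subst (λ y → Covers P₂ y _) (to-from (JoinBelow.j∈ J))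
            (covers-iso i (joinCovers (from∈ x∈) (atom-iso (Iso-sym i) atom)
              (λ a≤x → a≰x (subst (_≤ x) (to-from (proj₁ atom)) (to≤ (from∈ (proj₁ atom)) x∈ a≤x)))
              (join-iso (Iso-sym i) (from∈ (JoinBelow.j∈ J)) (from∈ x∈) (from∈ (proj₁ atom))
                (subst (λ v → JoinBelow P₂ v _ _ j) (sym (to-from (JoinBelow.j∈ J)))
                (subst (λ v → JoinBelow P₂ j v _ j) (sym (to-from x∈))
                (subst (λ v → JoinBelow P₂ j x v j) (sym (to-from (proj₁ atom))) J)))))))
      }
      where
      open LocalAxioms ax
      open ≡-Reasoning

    contraction-iso : ∀ {a} (a∈ : a ∈ support P) →
      Iso (contraction P (a , a∈)) (contraction P₂ (to a , to∈ a∈))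
    contraction-iso {a} a∈ = restrict i (proj₁ ∘ ∈⟪⟫⁻ (above? P a)) (proj₁ ∘ ∈⟪⟫⁻ (above? P₂ (to a)))
      (λ x∈ → let x∈P , a≤x = ∈⟪⟫⁻ (above? P a) x∈ in
        ∈⟪⟫⁺ (above? P₂ (to a)) (to∈ x∈P , to-mono a∈ x∈P a≤x))
      (λ y∈ → let y∈P , a≤y = ∈⟪⟫⁻ (above? P₂ (to a)) y∈ in
        ∈⟪⟫⁺ (above? P a) (from∈ y∈P , ≤from a∈ y∈P a≤y))

    deletion-iso : ∀ {a} (a∈ : a ∈ support P) →
      Iso (deletion P (a , a∈)) (deletion P₂ (to a , to∈ a∈))
    deletion-iso {a} a∈ = restrict i (proj₁ ∘ ∈-⟨⟩⁻ P B) (proj₁ ∘ ∈-⟨⟩⁻ P₂ B₂)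
      (λ x∈ → let x∈P , gen = ∈-⟨⟩⁻ P B x∈ in
        ∈-⟨⟩⁺ P₂ B₂ (to∈ x∈P) (generated-iso i (proj₁ ∘ proj₁ ∘ ∈-atoms-⁻ P) B→B₂ x∈P gen))
      (λ y∈ → let y∈P , gen = ∈-⟨⟩⁻ P₂ B₂ y∈ in
        ∈-⟨⟩⁺ P B (from∈ y∈P) (generated-iso (Iso-sym i) (proj₁ ∘ proj₁ ∘ ∈-atoms-⁻ P₂) B₂→B y∈P gen))
      where
      B B₂ : Subset n
      B = atoms P - a
      B₂ = atoms P₂ - to a
      B→B₂ : ∀ {b} → b ∈ B → to b ∈ B₂
      B→B₂ b∈ = let atom , b≢a = ∈-atoms-⁻ P b∈ in
        ∈-atoms-⁺ P₂ (atom-iso i atom) (b≢a ∘ to-injective (proj₁ atom) a∈)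
      B₂→B : ∀ {b} → b ∈ B₂ → from b ∈ B
      B₂→B b∈ = let atom , b≢a = ∈-atoms-⁻ P₂ b∈ in
        ∈-atoms-⁺ P (atom-iso (Iso-sym i) atom) λ { refl → b≢a (sym (to-from (proj₁ atom))) }

  ∣ᵖ-cong : ∀ {p p₂ q q₂} → (∀ k → coeff p k ≡ coeff p₂ k) → (∀ k → coeff q k ≡ coeff q₂ k) →
            p ∣ᵖ q → p₂ ∣ᵖ q₂
  ∣ᵖ-cong p≡p₂ q≡q₂ (r , eq) = r , λ k → trans (sym (q≡q₂ k)) (trans (eq k)
    (Sum.sum-cong-≗ {suc k} λ j → cong (ℤ._* coeff r (k ∸ toℕ j)) (p≡p₂ (toℕ j))))

  -- Deletion, contraction and `χ` respect isomorphisms, so a derivation is transported step by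
  -- step. It allows Q to stand in for the contraction.
  inductive-iso : ∀ {P P₂} → Iso P P₂ → Inductive P → Inductive P₂
  inductive-iso {P} {P₂} i (point eq) = point (⊆-antisym only0 λ {x} x∈ →
      subst (_∈ support P₂) (sym (x∈⁅y⁆⇒x≡y (0̂ P₂) x∈)) (0̂∈ P₂))
    where
    open Iso i
    only0 : support P₂ ⊆ ⁅ 0̂ P₂ ⁆
    only0 {x} x∈ = subst (_∈ ⁅ 0̂ P₂ ⁆) (sym (begin
      x           ≡⟨ to-from x∈ ⟨
      to (from x) ≡⟨ cong to (x∈⁅y⁆⇒x≡y (0̂ P) (subst (from x ∈_) eq (from∈ x∈))) ⟩
      to (0̂ P)    ≡⟨ to-0̂ ⟩
      0̂ P₂        ∎)) (x∈⁅x⁆ (0̂ P₂))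
      where open ≡-Reasoning
  inductive-iso {P} {P₂} i (step lg (a , a∈) atom contr del div) = step
    (axioms⇒locallyGeometric P₂ (axioms-iso i (locallyGeometric⇒axioms P lg)))
    (Iso.to i a , Iso.to∈ i a∈) (atom-iso i atom)
    (inductive-iso (contraction-iso i a∈) contr) (inductive-iso (deletion-iso i a∈) del)
    (∣ᵖ-cong {χ (contraction P (a , a∈))} {χ (contraction P₂ (Iso.to i a , Iso.to∈ i a∈))}
             {χ (deletion P (a , a∈))} {χ (deletion P₂ (Iso.to i a , Iso.to∈ i a∈))}
      (χ-iso (contraction-iso i a∈)) (χ-iso (deletion-iso i a∈)) div)

  -- Deletion and contraction at an atom.

  module DeletionContraction
    (P D C : FinitePoset O) (ax : LocalAxioms P) {a : Fin n} (atom : IsAtom P a)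
    (isDeletion : IsGenerated P D (atoms P - a))
    (0̂C≡a : 0̂ C ≡ a) (∈C⁺ : ∀ {x} → x ∈ support P → a ≤ x → x ∈ support C)
    (∈C⁻ : ∀ {x} → x ∈ support C → x ∈ support P × a ≤ x) where

    open LocalAxioms ax
    open Subposet P D ax (atoms P - a) (proj₁ ∘ ∈-atoms-⁻ P) isDeletion public

    a∈ : a ∈ support P
    a∈ = proj₁ atom

    a∉D : a ∉ support D
    a∉D = atom∉B⇒∉ atom (x∉p-x (atoms P) a)

    -- Any `x` other than `0̂` and `a` has an atom different from `a` below it, and this atom lies
    -- in `D`.
    top≡0̂⇔ : ∀ {x t} → x ∈ support P → Top x t → t ≡ 0̂ D ⇔ (x ≡ 0̂ P ⊎ x ≡ a)
    top≡0̂⇔ {x} {t} x∈ T = mk⇔ to from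
      where
      open Top T
      open IsGenerated isDeletion
      otherAtom : ∀ {b} → IsAtom P b → b ≢ a → b ≤ x → t ≢ 0̂ D
      otherAtom {b} b-atom b≢a b≤x t≡0 = atom⇒≢0̂ P b-atom
        (≤0̂⇒≡0̂ P (proj₁ b-atom) (subst (b ≤_) (trans t≡0 0̂≡)
          (greatest (B⊆ (∈-atoms-⁺ P b-atom b≢a)) b≤x)))
      to : t ≡ 0̂ D → x ≡ 0̂ P ⊎ x ≡ a
      to t≡0 with x ≟ 0̂ P | x ≟ a | a ≤? x
      ... | yes x≡0 | _       | _       = inj₁ x≡0
      ... | no _    | yes x≡a | _       = inj₂ x≡a
      ... | no _    | no x≢a  | yes a≤x
        with b , b-atom , b≤x , b≰a ← atomBelow-< a∈ x∈ (a≤x , x≢a ∘ sym) =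
        contradiction t≡0 (otherAtom b-atom (λ { refl → b≰a ≤-refl }) b≤x)
      ... | no x≢0  | no _    | no a≰x
        with b , b-atom , b≤x , _ ← atomBelow-< (0̂∈ P) x∈ (≢0̂⇒0̂< P x∈ x≢0) =
        contradiction t≡0 (otherAtom b-atom (λ { refl → a≰x b≤x }) b≤x)
      from : x ≡ 0̂ P ⊎ x ≡ a → t ≡ 0̂ D
      from (inj₁ refl) = trans (≤0̂⇒≡0̂ P (⊆P t∈) t≤) (sym 0̂≡)
      from (inj₂ refl) with below-atom P atom (⊆P t∈) t≤
      ... | inj₁ t≡0  = trans t≡0 (sym 0̂≡)
      ... | inj₂ refl = contradiction t∈ a∉D

    -- Both are extended by zero to all of `P`, with the sign of the contraction built in, so that
    -- their sum is a candidate for `μ-unique`.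
    μ-deletion μ-contraction : Fin n → ℤ
    μ-deletion    x = given (x ∈? support D) (λ _ → μ₀ D x) 0ℤ
    μ-contraction x = given (x ∈? support C) (λ _ → ℤ.- μ₀ C x) 0ℤ

    ∑-deletion : ∀ {x t} → x ∈ support P → Top x t → ∑ (below? P x) μ-deletion ≡ δ D t
    ∑-deletion {x} {t} x∈ T = begin
      ∑ (below? P x) μ-deletion ≡⟨ ∑-filter (below? P x) (_∈? support D) (μ₀ D) ⟩
      ∑ both? (μ₀ D)            ≡⟨ ∑-cong both? (below? D t)
        (λ ((_ , z≤x) , z∈) → z∈ , greatest z∈ z≤x)
        (λ (z∈ , z≤t) → (⊆P z∈ , ≤-trans z≤t t≤) , z∈) (λ _ → refl) ⟩
      ∑ (below? D t) (μ₀ D)     ≡⟨ μ-sum D t∈ ⟩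
      δ D t                     ∎
      where
      open ≡-Reasoning
      open Top T
      both? : Decidable (λ z → (z ∈ support P × z ≤ x) × z ∈ support D)
      both? z = below? P x z ×-dec z ∈? support D

    ∑-contraction : ∀ {x} → x ∈ support P →
      ∑ (below? P x) μ-contraction ≡ given (x ≟ a) (λ _ → ℤ.- 1ℤ) 0ℤ
    ∑-contraction {x} x∈ = trans (∑-filter (below? P x) (_∈? support C) (λ z → ℤ.- μ₀ C z)) total
      where
      open ≡-Reasoning
      both? : Decidable (λ z → (z ∈ support P × z ≤ x) × z ∈ support C)
      both? z = below? P x z ×-dec z ∈? support C
      sign : ∀ y z → ℤ.- given (y ≟ z) (λ _ → 1ℤ) 0ℤ ≡ given (y ≟ z) (λ _ → ℤ.- 1ℤ) 0ℤ
      sign y z with y ≟ z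
      ... | yes _ = refl
      ... | no _  = refl
      total : ∑ both? (λ z → ℤ.- μ₀ C z) ≡ given (x ≟ a) (λ _ → ℤ.- 1ℤ) 0ℤ
      total with a ≤? x
      ... | yes a≤x = begin
        ∑ both? (λ z → ℤ.- μ₀ C z)       ≡⟨ ∑-neg both? (μ₀ C) ⟩
        ℤ.- ∑ both? (μ₀ C)               ≡⟨ cong ℤ.-_ (∑-cong both? (below? C x)
          (λ ((_ , z≤x) , z∈) → z∈ , z≤x) (λ (z∈ , z≤x) → (proj₁ (∈C⁻ z∈) , z≤x) , z∈) (λ _ → refl)) ⟩
        ℤ.- ∑ (below? C x) (μ₀ C)        ≡⟨ cong ℤ.-_ (μ-sum C (∈C⁺ x∈ a≤x)) ⟩
        ℤ.- δ C x                       ≡⟨ sign x (0̂ C) ⟩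
        given (x ≟ 0̂ C) (λ _ → ℤ.- 1ℤ) 0ℤ ≡⟨ cong (λ v → given (x ≟ v) (λ _ → ℤ.- 1ℤ) 0ℤ) 0̂C≡a ⟩
        given (x ≟ a) (λ _ → ℤ.- 1ℤ) 0ℤ ∎
      ... | no a≰x = trans
        (∑-empty both? λ ((_ , z≤x) , z∈) → a≰x (≤-trans (proj₂ (∈C⁻ z∈)) z≤x))
        (sym (given-no (x ≟ a) λ { refl → a≰x ≤-refl }))

    -- Compare sums over lower intervals. By `top≡0̂⇔` the deletion contributes 1 at `0̂` and at `a`
    -- and 0 elsewhere; the contraction contributes -1 at `a` alone, which leaves `δ P`.
    μ-deletion-contraction : ∀ {x} → x ∈ support P → μ-deletion x ℤ.+ μ-contraction x ≡ μ₀ P x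
    μ-deletion-contraction = μ-unique P (λ x → μ-deletion x ℤ.+ μ-contraction x) total
      where
      total : ∀ {x} → x ∈ support P →
        ∑ (below? P x) (λ z → μ-deletion z ℤ.+ μ-contraction z) ≡ δ P x
      total {x} x∈ with t , T ← top-⟨⟩ x∈ = begin
        ∑ (below? P x) (λ z → μ-deletion z ℤ.+ μ-contraction z)
          ≡⟨ ∑-distrib-+ (below? P x) μ-deletion μ-contraction ⟩
        ∑ (below? P x) μ-deletion ℤ.+ ∑ (below? P x) μ-contraction
          ≡⟨ cong₂ ℤ._+_ (∑-deletion x∈ T) (∑-contraction x∈) ⟩
        δ D t ℤ.+ given (x ≟ a) (λ _ → ℤ.- 1ℤ) 0ℤ
          ≡⟨ cases ⟩
        δ P x ∎
        where
        open ≡-Reasoning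
        cases : δ D t ℤ.+ given (x ≟ a) (λ _ → ℤ.- 1ℤ) 0ℤ ≡ δ P x
        cases with x ≟ a | x ≟ 0̂ P
        ... | yes refl | yes a≡0  = contradiction a≡0 (atom⇒≢0̂ P atom)
        ... | yes refl | no _     =
          cong (ℤ._+ ℤ.- 1ℤ) (given-yes (t ≟ 0̂ D) (Equivalence.from (top≡0̂⇔ x∈ T) (inj₂ refl)))
        ... | no _     | yes refl =
          cong (ℤ._+ 0ℤ) (given-yes (t ≟ 0̂ D) (Equivalence.from (top≡0̂⇔ x∈ T) (inj₁ refl)))
        ... | no x≢a   | no x≢0   = cong (ℤ._+ 0ℤ) (given-no (t ≟ 0̂ D)
          (neither ∘ Equivalence.to (top≡0̂⇔ x∈ T)))
          where
          neither : ¬ (x ≡ 0̂ P ⊎ x ≡ a)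
          neither (inj₁ x≡0) = x≢0 x≡0
          neither (inj₂ x≡a) = x≢a x≡a

    -- The function `pred (rk P)` meets the criterion of `rk-unique`; `pred` loses nothing because
    -- elements above `a` have rank at least 1.
    rk-C : ∀ {x} → x ∈ support C → rk P x ≡ suc (rk C x)
    rk-C {x} x∈ = trans (sym (suc-pred-rk x∈))
        (cong suc (sym (rk-unique C (λ z → ℕ.pred (rk P z)) mono attained x∈)))
      where
      positive : ∀ {k} → rk P a ℕ.≤ k → suc (ℕ.pred k) ≡ k
      positive {zero}  rk≤ with () ← subst (ℕ._≤ 0) (proj₂ atom) rk≤
      positive {suc k} _   = refl
      suc-pred-rk : ∀ {z} → z ∈ support C → suc (ℕ.pred (rk P z)) ≡ rk P z
      suc-pred-rk z∈ = positive (rk-mono-≤ P a∈ (proj₂ (∈C⁻ z∈)))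
      mono : ∀ {y z} → y ∈ support C → z ∈ support C → y < z → ℕ.pred (rk P y) ℕ.< ℕ.pred (rk P z)
      mono y∈ z∈ y<z = ℕ.s≤s⁻¹ (begin
        suc (suc (ℕ.pred (rk P _))) ≡⟨ cong suc (suc-pred-rk y∈) ⟩
        suc (rk P _)                ≤⟨ rk-mono P (proj₁ (∈C⁻ y∈)) y<z ⟩
        rk P _                      ≡⟨ suc-pred-rk z∈ ⟨
        suc (ℕ.pred (rk P _))       ∎)
        where open ℕ.≤-Reasoning
      attained : ∀ {y} → y ∈ support C → ℕ.pred (rk P y) ≡ 0 ⊎
        (∃ λ z → z ∈ support C × z < y × ℕ.pred (rk P y) ≡ suc (ℕ.pred (rk P z)))
      attained {y} y∈ with y ≟ a
      ... | yes refl = inj₁ (cong ℕ.pred (proj₂ atom))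
      ... | no y≢a with y∈P , a≤y ← ∈C⁻ y∈
        with z , a≤z , cov@(z∈ , _ , z<y , _) ← coverBelow P a∈ y∈P (a≤y , y≢a ∘ sym) =
        inj₂ (z , ∈C⁺ z∈ a≤z , z<y , trans (cong ℕ.pred (graded cov)) (sym (suc-pred-rk (∈C⁺ z∈ a≤z))))

    -- The Möbius identity is summed over a fixed corank. Ranks in `D` are those of `P`, while ranks
    -- in `C` start at `a`, whence `s ∸ 1`. As `s` is arbitrary, this covers a `D` of smaller rank
    -- than `P`.
    X-deletion-contraction : ∀ s k → X P s k ≡ X D s k ℤ.+ ℤ.- X C (s ∸ 1) k
    X-deletion-contraction s k = begin
      ∑ (corank? P s k) (μ₀ P)
        ≡⟨ ∑-cong (corank? P s k) (corank? P s k) (λ p → p) (λ p → p)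
             (λ (x∈ , _) → μ-deletion-contraction x∈) ⟨
      ∑ (corank? P s k) (λ x → μ-deletion x ℤ.+ μ-contraction x)
        ≡⟨ ∑-distrib-+ (corank? P s k) μ-deletion μ-contraction ⟩
      ∑ (corank? P s k) μ-deletion ℤ.+ ∑ (corank? P s k) μ-contraction
        ≡⟨ cong₂ ℤ._+_ in-D in-C ⟩
      X D s k ℤ.+ ℤ.- X C (s ∸ 1) k ∎
      where
      open ≡-Reasoning
      in-D : ∑ (corank? P s k) μ-deletion ≡ X D s k
      in-D = trans (∑-filter (corank? P s k) (_∈? support D) (μ₀ D)) (∑-cong
        (λ x → corank? P s k x ×-dec x ∈? support D) (corank? D s k)
        (λ ((_ , eq) , x∈) → x∈ , trans (cong (s ∸_) (rk-⟨⟩ x∈)) eq)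
        (λ (x∈ , eq) → (⊆P x∈ , trans (cong (s ∸_) (sym (rk-⟨⟩ x∈))) eq) , x∈) (λ _ → refl))
      corank-C : ∀ {x} → x ∈ support C → s ∸ rk P x ≡ s ∸ 1 ∸ rk C x
      corank-C {x} x∈ = trans (cong (s ∸_) (rk-C x∈)) (sym (ℕ.∸-+-assoc s 1 (rk C x)))
      in-C : ∑ (corank? P s k) μ-contraction ≡ ℤ.- X C (s ∸ 1) k
      in-C = trans (∑-filter (corank? P s k) (_∈? support C) (λ x → ℤ.- μ₀ C x)) (trans (∑-cong
        (λ x → corank? P s k x ×-dec x ∈? support C) (corank? C (s ∸ 1) k)
        (λ ((_ , eq) , x∈) → x∈ , trans (sym (corank-C x∈)) eq)
        (λ (x∈ , eq) → (proj₁ (∈C⁻ x∈) , trans (corank-C x∈) eq) , x∈) (λ _ → refl))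
        (∑-neg (corank? C (s ∸ 1) k) (μ₀ C)))

  -- Deleting an atom outside the ideal.

  -- Joins with `a` and projections exist only on `Q` and on `C`, but `Iso` asks for total maps; the
  -- value outside `S` is a dummy.
  extend : {S : Pred (Fin n) 0ℓ} → Decidable S → (∀ x → S x → Fin n) → Fin n → Fin n
  extend S? f x with S? x
  ... | yes s = f x s
  ... | no _  = x

  extend-spec : {S : Pred (Fin n) 0ℓ} (S? : Decidable S) (f : ∀ x → S x → Fin n)
                (R : Fin n → Fin n → Set) → (∀ x (s : S x) → R x (f x s)) → ∀ {x} → S x → R x (extend S? f x)
  extend-spec S? f R spec {x} sx with S? x
  ... | yes s = spec x s
  ... | no ¬s = contradiction sx ¬s

  module FibrationDeletion
    (P Q D C : FinitePoset O) (fib : Fibration P Q)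
    {a : Fin n} (atom : IsAtom P a) (a∉ : a ∉ support Q)
    (isDeletion : IsGenerated P D (atoms P - a))
    (0̂C≡a : 0̂ C ≡ a) (∈C⁺ : ∀ {x} → x ∈ support P → a ≤ x → x ∈ support C)
    (∈C⁻ : ∀ {x} → x ∈ support C → x ∈ support P × a ≤ x) where

    open Fibration fib
    open DeletionContraction P D C axioms atom isDeletion 0̂C≡a ∈C⁺ ∈C⁻ public
    open IsGenerated isDeletion

    -- Both inverse laws come from covers. As a ∨ y covers `y`, its projection, which lies above `y`
    -- and strictly below a ∨ y, is `y`. As `x` covers π x, the join a ∨ π x, which lies strictly
    -- above π x and below `x`, is `x`.
    contraction≅Q : Iso Q C
    contraction≅Q = record
      { to = to ; from = from
      ; to∈ = to∈C
      ; from∈ = Projection.p∈ ∘ from-projection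
      ; to-mono = λ y∈ y′∈ y≤y′ → Join.least (to-join y∈) (Join.j∈ (to-join y′∈))
          (Join.left (to-join y′∈)) (≤-trans y≤y′ (Join.right (to-join y′∈)))
      ; from-mono = λ x∈ x′∈ x≤x′ → Projection.greatest (from-projection x′∈)
          (Projection.p∈ (from-projection x∈)) (≤-trans (from≤ x∈) x≤x′)
      ; from-to = from-to ; to-from = to-from }
      where
      a≰ : ∀ {y} → y ∈ support Q → ¬ (a ≤ y)
      a≰ y∈ a≤y = a∉ (downClosed a∈ y∈ a≤y)
      C∖Q : ∀ {x} → x ∈ support C → x ∉ support Q
      C∖Q x∈ x∈Q = a≰ x∈Q (proj₂ (∈C⁻ x∈))
      to from : Fin n → Fin n
      to   = extend (_∈? support Q) λ y y∈ → proj₁ (join atom a∉ y∈)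
      from = extend (_∈? support C) λ x x∈ → proj₁ (project (proj₁ (∈C⁻ x∈)) (C∖Q x∈))
      to-join : ∀ {y} → y ∈ support Q → Join P a y (to y)
      to-join = extend-spec (_∈? support Q) (λ y y∈ → proj₁ (join atom a∉ y∈)) (Join P a)
                  λ y y∈ → proj₂ (join atom a∉ y∈)
      from-projection : ∀ {x} → x ∈ support C → Projection P Q x (from x)
      from-projection = extend-spec (_∈? support C) (λ x x∈ → proj₁ (project (proj₁ (∈C⁻ x∈)) (C∖Q x∈)))
                          (Projection P Q) λ x x∈ → proj₂ (project (proj₁ (∈C⁻ x∈)) (C∖Q x∈))
      to∈C : ∀ {y} → y ∈ support Q → to y ∈ support C
      to∈C y∈ = ∈C⁺ (Join.j∈ (to-join y∈)) (Join.left (to-join y∈))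
      from< : ∀ {x} → x ∈ support C → from x < x
      from< x∈ = proj₁ (proj₂ (proj₂ (Projection.covers (from-projection x∈))))
      from≤ : ∀ {x} → x ∈ support C → from x ≤ x
      from≤ = proj₁ ∘ from<
      from-to : ∀ {y} → y ∈ support Q → from (to y) ≡ y
      from-to {y} y∈ with from (to y) ≟ y
      ... | yes eq = eq
      ... | no neq = contradiction
        ((Projection.greatest (from-projection (to∈C y∈)) y∈ (Join.right (to-join y∈)) , neq ∘ sym) ,
         from< (to∈C y∈))
        (proj₂ (proj₂ (proj₂ cov)) _ (subset (Projection.p∈ (from-projection (to∈C y∈)))))
        where
        open Join (to-join y∈)
        cov : Covers P (to y) y
        cov = LocalAxioms.joinCovers axioms (subset y∈) atom (a≰ y∈) (record
          { j∈ = j∈ ; left = right ; right = left ; j≤t = ≤-refl ; least = λ v∈ y≤v a≤v _ → least v∈ a≤v y≤v })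
      to-from : ∀ {x} → x ∈ support C → to (from x) ≡ x
      to-from {x} x∈ with to (from x) ≟ x
      ... | yes eq = eq
      ... | no neq = contradiction
        ((right , λ eq → a≰ p∈ (subst (a ≤_) (sym eq) left)) ,
         least (proj₁ (∈C⁻ x∈)) (proj₂ (∈C⁻ x∈)) (from≤ x∈) , neq)
        (proj₂ (proj₂ (proj₂ covers)) _ j∈)
        where
        open Projection (from-projection x∈) using (p∈; covers)
        open Join (to-join p∈)

    -- Atoms below an element of `Q` lie in `Q` and so differ from `a`. Anything strictly below `q`
    -- misses one of them.
    Q⊆D : support Q ⊆ support D
    Q⊆D {q} q∈ = ∈⁺ (subset q∈) generated
      where
      generated : Generated P (atoms P - a) q
      generated {v} v∈ v≤q above with v ≟ q
      ... | yes v≡q = v≡q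
      ... | no v≢q with b , b-atom , b≤q , b≰v ← LocalAxioms.atomBelow-< axioms v∈ (subset q∈) (v≤q , v≢q) =
        contradiction (above (∈-atoms-⁺ P b-atom λ { refl → a∉ (downClosed a∈ q∈ b≤q) }) b≤q) b≰v

    -- Projections and joins are inherited unchanged: a cover of `P` between elements of `D` is a
    -- cover of `D`, and `join-∈` keeps the joins in `D`.
    deletion-fibration : Fibration D Q
    deletion-fibration = record
      { axioms     = axioms-⟨⟩
      ; subset     = Q⊆D
      ; downClosed = downClosed ∘ ⊆P
      ; project    = λ x∈ x∉ → let p , π = project (⊆P x∈) x∉ in p , project-D x∈ π
      ; join       = λ b-atom b∉ y∈ →
          let j , J = join (atom-⟨⟩⁻ b-atom) b∉ y∈ in j , join-D (proj₁ b-atom) (Q⊆D y∈) J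
      }
      where
      project-D : ∀ {x p} → x ∈ support D → Projection P Q x p → Projection D Q x p
      project-D x∈ π with _ , _ , p<x , none ← Projection.covers π = record
        { p∈ = Projection.p∈ π
        ; covers = Q⊆D (Projection.p∈ π) , x∈ , p<x , λ z z∈ → none z (⊆P z∈)
        ; greatest = Projection.greatest π }
      join-D : ∀ {b y j} → b ∈ support D → y ∈ support D → Join P b y j → Join D b y j
      join-D b∈ y∈ J = record
        { j∈ = join-∈ b∈ y∈ (record { j∈ = j∈ ; left = left ; right = right ; j≤t = ≤-refl
                                    ; least = λ v∈ b≤v y≤v _ → least v∈ b≤v y≤v })
        ; left = left ; right = right ; least = least ∘ ⊆P }
        where open Join J

  -- The linear factor and the induction on atoms outside the ideal.

  -- In terms of χ: χ P = (t + c) χ Q if rank P = rank Q + 1, where − c is the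
  -- number of atoms of P outside Q, and χ P = χ Q if there are none.
  LinearFactor : FinitePoset O → FinitePoset O → ℤ → Set
  LinearFactor Q P c = ∀ s k → X P s k ≡ X Q s k ℤ.+ c ℤ.* X Q (s ∸ 1) k

  module _ {P Q : FinitePoset O} (fib : Fibration P Q) where
    open Fibration fib

    -- For `x` outside `Q`, an atom below `x` but not below its projection cannot lie in `Q`, as the
    -- projection is greatest.
    atomOutside-or-⊆ : (∃ λ a → IsAtom P a × a ∉ support Q) ⊎ support P ⊆ support Q
    atomOutside-or-⊆ with any? (λ a → atom? P a ×-dec ¬? (a ∈? support Q))
    ... | yes found = inj₁ found
    ... | no none   = inj₂ P⊆Q
      where
      P⊆Q : support P ⊆ support Q
      P⊆Q {x} x∈ with x ∈? support Q
      ... | yes x∈Q = x∈Q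
      ... | no x∉Q with p , π ← project x∈ x∉Q
        with a , atom , a≤x , a≰p ← LocalAxioms.atomBelow axioms (Projection.covers π) =
        contradiction (a , atom , λ a∈ → a≰p (Projection.greatest π a∈ a≤x)) none

    -- Projecting to `Q` costs one rank, which gives the upper bound; joining `a` to an element of
    -- `Q` of largest rank leads strictly upwards.
    rank-fibration : ∀ {a} → IsAtom P a → a ∉ support Q → rank P ≡ suc (rank Q)
    rank-fibration {a} atom a∉ = ℕ.≤-antisym upper lower
      where
      rk-Q : ∀ {x} → x ∈ support Q → rk Q x ≡ rk P x
      rk-Q = rk-ideal P Q subset downClosed
      upper : rank P ℕ.≤ suc (rank Q)
      upper with x , x∈ , eq ← rank-attained P with x ∈? support Q
      ... | yes x∈Q rewrite eq | sym (rk-Q x∈Q) = ℕ.m≤n⇒m≤1+n (rank-upper Q x∈Q)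
      ... | no x∉Q with p , π ← project x∈ x∉Q
        rewrite eq | LocalAxioms.graded axioms (Projection.covers π) | sym (rk-Q (Projection.p∈ π)) =
        s≤s (rank-upper Q (Projection.p∈ π))
      lower : rank Q ℕ.< rank P
      lower with x , x∈ , eq ← rank-attained Q with j , J ← join atom a∉ x∈
        rewrite eq | rk-Q x∈ = ℕ.<-≤-trans
          (rk-mono P (subset x∈) (Join.right J , λ { refl → a∉ (downClosed (proj₁ atom) x∈ (Join.left J)) }))
          (rank-upper P (Join.j∈ J))

    -- The quotient is t + c only when the ranks differ by one, that is, when some atom lies outside
    -- `Q`. Otherwise `P` and `Q` have the same elements and the quotient is 1.
    linearFactor⇒∣ᵖ : ∀ c → LinearFactor Q P c → χ Q ∣ᵖ χ P
    linearFactor⇒∣ᵖ c rel with atomOutside-or-⊆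
    ... | inj₂ P⊆Q = linear-∣ᵖ {χ Q} {χ P} 1ℤ 0ℤ
      (trans (same 0) (sym (ℤ.*-identityʳ (coeff (χ Q) 0))))
      (λ k → trans (same (suc k)) (sym (trans
        (cong₂ ℤ._+_ (ℤ.*-zeroʳ (coeff (χ Q) k)) (ℤ.*-identityʳ (coeff (χ Q) (suc k))))
        (ℤ.+-identityˡ (coeff (χ Q) (suc k))))))
      where
      same : ∀ k → coeff (χ P) k ≡ coeff (χ Q) k
      same = χ-iso {P} {Q} (⊆⊇⇒Iso P⊆Q subset)
    ... | inj₁ (a , atom , a∉) = linear-∣ᵖ {χ Q} {χ P} c 1ℤ
      (trans (χP 0) (trans (cong₂ ℤ._+_ shift₀ (ℤ.*-comm c (X Q R 0))) (ℤ.+-identityˡ (X Q R 0 ℤ.* c))))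
      (λ k → trans (χP (suc k)) (cong₂ ℤ._+_
        (trans (shift k) (sym (ℤ.*-identityʳ (X Q R k)))) (ℤ.*-comm c (X Q R (suc k)))))
      where
      R : ℕ
      R = rank Q
      χP : ∀ k → X P (rank P) k ≡ X Q (suc R) k ℤ.+ c ℤ.* X Q R k
      χP k = trans (cong (λ r → X P r k) (rank-fibration atom a∉)) (rel (suc R) k)
      suc-corank : ∀ {x} → x ∈ support Q → suc R ∸ rk Q x ≡ suc (R ∸ rk Q x)
      suc-corank x∈ = ℕ.+-∸-assoc 1 (rank-upper Q x∈)
      -- Measuring coranks in `Q` from `suc R` instead of `R` multiplies by t: the constant
      -- coefficient vanishes and the others move up by one.
      shift₀ : X Q (suc R) 0 ≡ 0ℤ
      shift₀ = ∑-empty (corank? Q (suc R) 0) λ (x∈ , eq) → ℕ.1+n≢0 (trans (sym (suc-corank x∈)) eq)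
      shift : ∀ k → X Q (suc R) (suc k) ≡ X Q R k
      shift k = ∑-cong (corank? Q (suc R) (suc k)) (corank? Q R k)
        (λ (x∈ , eq) → x∈ , ℕ.suc-injective (trans (sym (suc-corank x∈)) eq))
        (λ (x∈ , eq) → x∈ , trans (suc-corank x∈) (cong suc eq)) (λ _ → refl)

  -- The step needs χ_Q to divide the polynomial of the deletion, so the induction carries the
  -- linear factor along with inductiveness. The support shrinks because `a` is lost.
  fibration⇒inductive : ∀ {P Q} → Fibration P Q → Inductive Q → Inductive P × ∃ (LinearFactor Q P)
  fibration⇒inductive {P} {Q} fib ind = go P fib (<-wellFounded ∣ support P ∣)
    where
    go : ∀ P → Fibration P Q → Acc ℕ._<_ ∣ support P ∣ → Inductive P × ∃ (LinearFactor Q P)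
    go P fib (acc rs) with atomOutside-or-⊆ fib
    ... | inj₂ P⊆Q = inductive-iso i ind , 0ℤ , λ s k →
        trans (sym (X-iso i s k)) (sym (ℤ.+-identityʳ (X Q s k)))
      where
      i : Iso Q P
      i = ⊆⊇⇒Iso (Fibration.subset fib) P⊆Q
    ... | inj₁ (a , atom , a∉) = P-inductive , proj₁ factor ℤ.- 1ℤ , factor′
      where
      D C : FinitePoset O
      D = deletion P (a , proj₁ atom)
      C = contraction P (a , proj₁ atom)
      module F = FibrationDeletion P Q D C fib atom a∉ (⟨⟩-isGenerated P (atoms P - a)) refl
        (λ x∈ a≤x → ∈⟪⟫⁺ (above? P a) (x∈ , a≤x)) (∈⟪⟫⁻ (above? P a))
      hyp : Inductive D × ∃ (LinearFactor Q D)
      hyp = go D F.deletion-fibration (rs (p⊂q⇒∣p∣<∣q∣ (F.⊆P , a , proj₁ atom , F.a∉D)))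
      factor : ∃ (LinearFactor Q D)
      factor = proj₂ hyp
      P-inductive : Inductive P
      P-inductive = step (axioms⇒locallyGeometric P (Fibration.axioms fib)) (a , proj₁ atom) atom
        (inductive-iso F.contraction≅Q ind) (proj₁ hyp)
        -- The divisor supplied by the fibration is χ_Q; the isomorphism between `Q` and `C` turns
        -- it into that of the contraction.
        (∣ᵖ-cong {χ Q} {χ C} {χ D} {χ D} (χ-iso {Q} {C} F.contraction≅Q) (λ _ → refl)
          (linearFactor⇒∣ᵖ F.deletion-fibration (proj₁ factor) (proj₂ factor)))
      factor′ : LinearFactor Q P (proj₁ factor ℤ.- 1ℤ)
      factor′ s k = begin
        X P s k                                 ≡⟨ F.X-deletion-contraction s k ⟩
        X D s k ℤ.+ ℤ.- X C (s ∸ 1) k           ≡⟨ cong₂ ℤ._+_ (proj₂ factor s k)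
                                                    (cong ℤ.-_ (sym (X-iso F.contraction≅Q (s ∸ 1) k))) ⟩
        (u ℤ.+ c ℤ.* v) ℤ.+ ℤ.- v               ≡⟨ ℤ.+-assoc u (c ℤ.* v) (ℤ.- v) ⟩
        u ℤ.+ (c ℤ.* v ℤ.+ ℤ.- v)               ≡⟨ cong (λ w → u ℤ.+ (c ℤ.* v ℤ.+ w)) (ℤ.-1*i≡-i v) ⟨
        u ℤ.+ (c ℤ.* v ℤ.+ (ℤ.- 1ℤ) ℤ.* v)      ≡⟨ cong (λ w → u ℤ.+ w) (ℤ.*-distribʳ-+ v c (ℤ.- 1ℤ)) ⟨
        u ℤ.+ (c ℤ.- 1ℤ) ℤ.* v                  ∎
        where
        open ≡-Reasoning
        c u v : ℤ
        c = proj₁ factor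
        u = X Q s k
        v = X Q (s ∸ 1) k

theorem1p3 :
    ∀ {n} {_≤_ : Rel (Fin n) 0ℓ} {O : IsDecPartialOrder _≡_ _≤_} (P : FinitePoset O) →
    LocallyGeometric P → StrictlySupersolvable P → Inductive P
theorem1p3 P _ ss = inductive-iso
  -- The last member of the chain shares only its support with `P`, so the result is carried over by
  -- the identity isomorphism.
  (⊆⊇⇒Iso (λ {x} → subst (x ∈_) top) (λ {x} → subst (x ∈_) (sym top)))
  (<-weakInduction (Inductive ∘ Q) base
    (λ i → proj₁ ∘ fibration⇒inductive
      (tmIdeal⇒fibration (Q (fsuc i)) (Q (inject₁ i)) (tmIdeals i) (rank-suc i)))
    (fromℕ r))
  where
  open StrictlySupersolvable ss
  base : Inductive (Q fzero)
  -- `bottom` mentions the least element of `P` but `point` that of `Q fzero`; the latter lies in a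
  -- singleton holding the former.
  base = point (trans bottom
    (cong ⁅_⁆ (sym (x∈⁅y⁆⇒x≡y (0̂ P) (subst (0̂ (Q fzero) ∈_) bottom (0̂∈ (Q fzero)))))))
  rank-suc : ∀ i → rank (Q (fsuc i)) ≡ suc (rank (Q (inject₁ i)))
  rank-suc i = trans (ranks (fsuc i)) (cong suc (sym (trans (ranks (inject₁ i)) (toℕ-inject₁ i))))
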